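{- Let $\widehat{\mathcal{T}}=(\mathbb{Z}^+)^{\infty}$ be the set of all infinite sequences $\mathbf{k}=(k_1,k_2,\ldots)$ of positive integers. The map \[ \eta_{ -1}:\widehat{\mathcal{T}}\to\left[\tfrac12,1\right),\qquad \mathbf{k}\mapsto\lim_{r\to+\infty}\ \sum_{n_1\geq\cdots\geq n_r\geq 1}\frac{(-1)^{n_1-1}}{n_1^{k_1}\cdots n_r^{k_r}} \] is (well defined and) bijective.
   Context: The inner multiple sums are understood as limits of partial sums with respect to the outer variable $n_1$: for each $n_1$ one first sums over the finitely many $n_1\ge n_2\ge\cdots\ge n_r\ge1$, and then one sums over $n_1=1,2,3,\ldots$ (this convention matters only when $k_1=1$, where convergence is conditional). -}

module Defs where

open import Data.Nat.Base as ℕ using (ℕ; zero; suc; NonZero)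
import Data.Nat.Properties as ℕ
open import Data.Integer.Base as ℤ using (-1ℤ)
open import Data.Irrelevant using ([_])
open import Data.Product.Base using (∃; _×_; _,_; proj₁; proj₂)
open import Data.Rational.Base using (ℚ; 0ℚ; 1ℚ; ½; _+_; _-_; _*_; -_; ∣_∣; _<_; _≤_; _/_)
open import Data.Rational.Properties
open import Data.Rational.Solver using (module +-*-Solver)
open import Data.Refinement.Base using (Refinement-syntax; value; _,_)
open import Data.Sum.Base using (inj₁; inj₂)
open import Data.Vec.Base using (Vec; []; _∷_)
open import Function.Base using (_∘_)
open import Level using (0ℓ)
open import Relation.Binary.Bundles using (Setoid)
import Relation.Binary.Construct.On as On
open import Relation.Binary.PropositionalEquality
  using (_≡_; refl; sym; trans; cong; cong₂; subst; _→-setoid_)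

open +-*-Solver using (solve; _:=_; _:+_; _:-_; :-_)

private
  ½-pos : ∀ {ε} → 0ℚ < ε → 0ℚ < ½ * ε
  ½-pos {ε} 0<ε = subst (_< ½ * ε) (*-zeroʳ ½) (*-monoʳ-<-pos ½ 0<ε)

  halves : ∀ ε → ½ * ε + ½ * ε ≡ ε
  halves ε = trans (sym (*-distribʳ-+ ε ½ ½)) (*-identityˡ ε)

  add-halves : ∀ {p q s ε} → ∣ s ∣ ≤ ∣ p ∣ + ∣ q ∣ →
               ∣ p ∣ < ½ * ε → ∣ q ∣ < ½ * ε → ∣ s ∣ < ε
  add-halves {ε = ε} s≤ p< q< =
    ≤-<-trans s≤ (subst (_ <_) (halves ε) (+-mono-< p< q<))

  ∣-∣-sym : ∀ p q → ∣ p - q ∣ ≡ ∣ q - p ∣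
  ∣-∣-sym p q = trans
    (cong ∣_∣ (solve 2 (λ p q → p :- q := :- (q :- p)) refl p q))
    (∣-p∣≡∣p∣ (q - p))

  triangle : ∀ p q r → ∣ p - r ∣ ≤ ∣ p - q ∣ + ∣ q - r ∣
  triangle p q r = subst (λ t → ∣ t ∣ ≤ ∣ p - q ∣ + ∣ q - r ∣)
    (solve 3 (λ p q r → (p :- q) :+ (q :- r) := p :- r) refl p q r)
    (∣p+q∣≤∣p∣+∣q∣ (p - q) (q - r))

  ∣∣-∣∣≤ : ∀ p q → ∣ p ∣ - ∣ q ∣ ≤ ∣ p - q ∣
  ∣∣-∣∣≤ p q = subst (∣ p ∣ - ∣ q ∣ ≤_)
    (solve 2 (λ d b → (d :+ b) :- b := d) refl ∣ p - q ∣ ∣ q ∣)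
    (+-monoˡ-≤ (- ∣ q ∣)
      (subst (λ t → ∣ t ∣ ≤ ∣ p - q ∣ + ∣ q ∣)
        (solve 2 (λ p q → (p :- q) :+ q := p) refl p q)
        (∣p+q∣≤∣p∣+∣q∣ (p - q) q)))

IsCauchy : (ℕ → ℚ) → Set
IsCauchy x = ∀ ε → 0ℚ < ε →
  ∃ λ N → ∀ m n → N ℕ.≤ m → N ℕ.≤ n → ∣ x m - x n ∣ < ε

record ℝ : Set where
  constructor mkℝ
  field
    seq    : ℕ → ℚ
    cauchy : IsCauchy seq

open ℝ public

infix 4 _≈ᵣ_ _<ᵣ_ _≤ᵣ_
infixl 6 _-ᵣ_

_≈ᵣ_ : ℝ → ℝ → Set
x ≈ᵣ y = ∀ ε → 0ℚ < ε → ∃ λ N → ∀ n → N ℕ.≤ n → ∣ seq x n - seq y n ∣ < ε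

_<ᵣ_ : ℝ → ℝ → Set
x <ᵣ y = ∃ λ ε → 0ℚ < ε × ∃ λ N → ∀ n → N ℕ.≤ n → seq x n + ε < seq y n

_≤ᵣ_ : ℝ → ℝ → Set
x ≤ᵣ y = ∀ ε → 0ℚ < ε → ∃ λ N → ∀ n → N ℕ.≤ n → seq x n < seq y n + ε

fromℚ : ℚ → ℝ
fromℚ q = mkℝ (λ _ → q)
  (λ ε 0<ε → 0 , λ _ _ _ _ → subst (_< ε) (cong ∣_∣ (sym (+-inverseʳ q))) 0<ε)

_-ᵣ_ : ℝ → ℝ → ℝ
x -ᵣ y = mkℝ (λ n → seq x n - seq y n) isCauchy
  where
  isCauchy : IsCauchy (λ n → seq x n - seq y n)
  isCauchy ε 0<ε with cauchy x (½ * ε) (½-pos 0<ε) | cauchy y (½ * ε) (½-pos 0<ε)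
  ... | M , p | N , q = M ℕ.⊔ N , λ m n m≥ n≥ →
    add-halves
      (subst (λ t → ∣ t ∣ ≤ ∣ seq x m - seq x n ∣ + ∣ seq y m - seq y n ∣)
        (solve 4 (λ a b c d → (a :- b) :- (c :- d) := (a :- c) :- (b :- d))
          refl (seq x m) (seq x n) (seq y m) (seq y n))
        (∣p-q∣≤∣p∣+∣q∣ (seq x m - seq x n) (seq y m - seq y n)))
      (p m n (ℕ.m⊔n≤o⇒m≤o M N m≥) (ℕ.m⊔n≤o⇒m≤o M N n≥))
      (q m n (ℕ.m⊔n≤o⇒n≤o M N m≥) (ℕ.m⊔n≤o⇒n≤o M N n≥))

∣_∣ᵣ : ℝ → ℝ
∣ x ∣ᵣ = mkℝ (∣_∣ ∘ seq x) isCauchy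
  where
  bound : ∀ p q → ∣ ∣ p ∣ - ∣ q ∣ ∣ ≤ ∣ p - q ∣
  bound p q with ∣p∣≡p∨∣p∣≡-p (∣ p ∣ - ∣ q ∣)
  ... | inj₁ eq = subst (_≤ ∣ p - q ∣) (sym eq) (∣∣-∣∣≤ p q)
  ... | inj₂ eq = subst (_≤ ∣ p - q ∣) (sym (trans eq flip)) flipped
    where
    flip : - (∣ p ∣ - ∣ q ∣) ≡ ∣ q ∣ - ∣ p ∣
    flip = solve 2 (λ a b → :- (a :- b) := b :- a) refl ∣ p ∣ ∣ q ∣
    flipped : ∣ q ∣ - ∣ p ∣ ≤ ∣ p - q ∣
    flipped = subst (∣ q ∣ - ∣ p ∣ ≤_) (∣-∣-sym q p) (∣∣-∣∣≤ q p)

  isCauchy : IsCauchy (∣_∣ ∘ seq x)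
  isCauchy ε 0<ε with cauchy x ε 0<ε
  ... | N , p = N , λ m n m≥ n≥ → ≤-<-trans (bound (seq x m) (seq x n)) (p m n m≥ n≥)

ℝ-setoid : Setoid 0ℓ 0ℓ
ℝ-setoid = record
  { Carrier       = ℝ
  ; _≈_           = _≈ᵣ_
  ; isEquivalence = record
    { refl  = λ {x} ε 0<ε → 0 , λ n _ →
        subst (_< ε) (cong ∣_∣ (sym (+-inverseʳ (seq x n)))) 0<ε
    ; sym   = λ {x} {y} x≈y ε 0<ε → proj₁ (x≈y ε 0<ε) , λ n n≥ →
        subst (_< ε) (∣-∣-sym (seq x n) (seq y n)) (proj₂ (x≈y ε 0<ε) n n≥)
    ; trans = λ {x} {y} {z} → ≈ᵣ-trans {x} {y} {z}
    }
  }
  where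
  ≈ᵣ-trans : ∀ {x y z} → x ≈ᵣ y → y ≈ᵣ z → x ≈ᵣ z
  ≈ᵣ-trans {x} {y} {z} x≈y y≈z ε 0<ε
    with x≈y (½ * ε) (½-pos 0<ε) | y≈z (½ * ε) (½-pos 0<ε)
  ... | M , p | N , q = M ℕ.⊔ N , λ n n≥ →
    add-halves (triangle (seq x n) (seq y n) (seq z n))
      (p n (ℕ.m⊔n≤o⇒m≤o M N n≥)) (q n (ℕ.m⊔n≤o⇒n≤o M N n≥))

infix 4 _⟶_

_⟶_ : (ℕ → ℝ) → ℝ → Set
u ⟶ ℓ = ∀ ε → 0ℚ < ε → ∃ λ N → ∀ n → N ℕ.≤ n → ∣ u n -ᵣ ℓ ∣ᵣ <ᵣ fromℚ ε

[½,1⟩ : Setoid 0ℓ 0ℓ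
[½,1⟩ = On.setoid {B = ∃ λ x → fromℚ ½ ≤ᵣ x × x <ᵣ fromℚ 1ℚ} ℝ-setoid proj₁

ℤ⁺ : Set
ℤ⁺ = [ n ∈ ℕ ∣ NonZero n ]

-- The entry k₁ is at position 0, and equality is pointwise.

𝒯̂ : Setoid 0ℓ 0ℓ
𝒯̂ = ℕ →-setoid ℤ⁺

-- ∑≥ r N f is the sum of f (n₁ ∷ … ∷ nᵣ ∷ []) over N ≥ n₁ ≥ … ≥ nᵣ ≥ 1.

∑≥ : ∀ r → ℕ → (Vec ℤ⁺ r → ℚ) → ℚ
∑≥ zero    _       f = f []
∑≥ (suc r) zero    f = 0ℚ
∑≥ (suc r) (suc N) f =
  ∑≥ (suc r) N f + ∑≥ r (suc N) (λ ns → f ((suc N , [ _ ]) ∷ ns))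

denom : ∀ {r} → (ℕ → ℤ⁺) → Vec ℤ⁺ r → ℕ
denom k []       = 1
denom k (n ∷ ns) = value n ℕ.^ value (k 0) ℕ.* denom (k ∘ suc) ns

denom-nonZero : ∀ {r} k (ns : Vec ℤ⁺ r) → NonZero (denom k ns)
denom-nonZero k []               = _
denom-nonZero k ((n , [ n≢0 ]) ∷ ns) =
  ℕ.m*n≢0 (n ℕ.^ value (k 0)) (denom (k ∘ suc) ns)
    {{ℕ.m^n≢0 n (value (k 0)) {{n≢0}}}} {{denom-nonZero (k ∘ suc) ns}}

term : ∀ {r} → (ℕ → ℤ⁺) → Vec ℤ⁺ (suc r) → ℚ
term k (n ∷ ns) =
  _/_ (-1ℤ ℤ.^ (value n ℕ.∸ 1)) (denom k (n ∷ ns)) {{denom-nonZero k (n ∷ ns)}}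

-- S r is the sum of depth r + 1 (depth 0 has no n₁), taken as the limit of
-- its partial sums over n₁ ≤ N.

IsEta₋₁ : (ℕ → ℤ⁺) → ℝ → Set
IsEta₋₁ k x = ∃ λ (S : ℕ → ℝ) →
  (∀ r → (λ N → fromℚ (∑≥ (suc r) N (term k))) ⟶ S r) × S ⟶ x

{-# OPTIONS --safe #-}

-- A finite composition acts on sequences by composing the running mean and the
-- division by i + 1.  These two operators are exchanged by the binomial
-- transform, so Euler's transformation rewrites the alternating sum of depth r
-- as Σᵢ 2^-(i+1) b i, where b is the image of the constant sequence 𝟏 under
-- the first r entries of k.  Both operators preserve positivity, and halve a
-- difference bounded by a multiple of i.  Hence the images of δ = (1,0,0,…) and
-- of 𝟏 under longer and longer prefixes bound nested intervals of length at
-- most 2^-r, and the children of an interval, one for each next entry, tile it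
-- without its right endpoint.  As in a positional number system, each point of
-- [½ , 1) has exactly one expansion.

module Submission where

open import Defs
open import Axiom.ExcludedMiddle using (ExcludedMiddle)
open import Data.Integer.Base as ℤ using (ℤ; -1ℤ; 1ℤ)
import Data.Integer.Properties as ℤ
open import Data.Irrelevant using ([_])
open import Data.List.Base using (List; []; _∷_; _∷ʳ_; length; applyUpTo)
open import Data.List.Properties using (applyUpTo-∷ʳ; length-applyUpTo)
open import Data.Nat.Base as ℕ using (ℕ; zero; suc; NonZero)
import Data.Nat.Properties as ℕ
open import Data.Product.Base using (∃; _×_; _,_; proj₁; proj₂)
open import Data.Rational.Base hiding (NonZero; truncate)
open import Data.Rational.Properties
open import Data.Rational.Solver using (module +-*-Solver)
import Data.Rational.Unnormalised.Base as ℚᵘ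
import Data.Rational.Unnormalised.Properties as ℚᵘ
open import Data.Refinement.Base using (value; _,_)
open import Data.Refinement.Properties using (value-injective)
open import Data.Sum.Base using (inj₁; inj₂)
open import Data.Vec.Base using (Vec; []; _∷_)
open import Function.Base using (_∘_)
open import Function.Bundles using (Bijection)
open import Level using (0ℓ)
open import Relation.Binary.Bundles using (Setoid)
open import Relation.Binary.Definitions using (tri<; tri≈; tri>)
open import Relation.Binary.PropositionalEquality hiding ([_])
open import Relation.Nullary using (¬_; yes; no; contradiction)

open +-*-Solver using (solve; _:=_; _:+_; _:*_; _:-_; :-_; con)

-- Rational arithmetic and powers of one half.

-- Transfers an inequality along an equality of differences, so that the ring solver does the
-- remaining algebra.
≤-by-diff : ∀ {a b c d} → d - c ≡ b - a → a ≤ b → c ≤ d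
≤-by-diff {a} {b} {c} {d} eq a≤b = subst₂ _≤_
  (solve 2 (λ a c → a :+ (c :- a) := c) refl a c)
  (trans (trans (solve 3 (λ a b c → b :+ (c :- a) := c :+ (b :- a)) refl a b c)
                (cong (c +_) (sym eq)))
         (solve 2 (λ c d → c :+ (d :- c) := d) refl c d))
  (+-monoˡ-≤ (c - a) a≤b)

<-by-diff : ∀ {a b c d} → d - c ≡ b - a → a < b → c < d
<-by-diff {a} {b} {c} {d} eq a<b = subst₂ _<_
  (solve 2 (λ a c → a :+ (c :- a) := c) refl a c)
  (trans (trans (solve 3 (λ a b c → b :+ (c :- a) := c :+ (b :- a)) refl a b c)
                (cong (c +_) (sym eq)))
         (solve 2 (λ c d → c :+ (d :- c) := d) refl c d))
  (+-monoˡ-< (c - a) a<b)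

*-monoˡ-≤ : ∀ {a b c} → 0ℚ ≤ c → a ≤ b → c * a ≤ c * b
*-monoˡ-≤ {c = c} 0≤c = *-monoˡ-≤-nonNeg c {{nonNegative 0≤c}}

*-monoˡ-< : ∀ {a b c} → 0ℚ < c → a < b → c * a < c * b
*-monoˡ-< {c = c} 0<c = *-monoʳ-<-pos c {{positive 0<c}}

*-cancelˡ-≤ : ∀ {a b c} → 0ℚ < c → c * a ≤ c * b → a ≤ b
*-cancelˡ-≤ {c = c} 0<c = *-cancelˡ-≤-pos c {{positive 0<c}}

*-cancelˡ-≡ : ∀ {a b c} → 0ℚ < c → c * a ≡ c * b → a ≡ b
*-cancelˡ-≡ 0<c eq = ≤-antisym
  (*-cancelˡ-≤ 0<c (≤-reflexive eq)) (*-cancelˡ-≤ 0<c (≤-reflexive (sym eq)))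

0≤* : ∀ {a b} → 0ℚ ≤ a → 0ℚ ≤ b → 0ℚ ≤ a * b
0≤* {a} {b} 0≤a 0≤b = subst (_≤ a * b) (*-zeroʳ a) (*-monoˡ-≤ 0≤a 0≤b)

0≤+ : ∀ {a b} → 0ℚ ≤ a → 0ℚ ≤ b → 0ℚ ≤ a + b
0≤+ = +-mono-≤

0≤½ : 0ℚ ≤ ½
0≤½ = nonNegative⁻¹ ½

0<½ : 0ℚ < ½
0<½ = positive⁻¹ ½

½*-pos : ∀ {a} → 0ℚ < a → 0ℚ < ½ * a
½*-pos {a} 0<a = subst (_< ½ * a) (*-zeroʳ ½) (*-monoˡ-< 0<½ 0<a)

∣-∣≤ : ∀ {a b c} → a - b ≤ c → b - a ≤ c → ∣ a - b ∣ ≤ c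
∣-∣≤ {a} {b} {c} a-b≤c b-a≤c with ≤-total 0ℚ (a - b)
... | inj₁ 0≤ = subst (_≤ c) (sym (0≤p⇒∣p∣≡p 0≤)) a-b≤c
... | inj₂ ≤0 = subst (_≤ c) eq b-a≤c
  where
  eq : b - a ≡ ∣ a - b ∣
  eq = trans (sym (0≤p⇒∣p∣≡p (≤-by-diff
         (solve 2 (λ a b → (b :- a) :- con 0ℚ := con 0ℚ :- (a :- b)) refl a b) ≤0)))
       (trans (cong ∣_∣ (solve 2 (λ a b → b :- a := :- (a :- b)) refl a b)) (∣-p∣≡∣p∣ (a - b)))

p≤∣p∣ : ∀ p → p ≤ ∣ p ∣
p≤∣p∣ p with ≤-total 0ℚ p
... | inj₁ 0≤p = ≤-reflexive (sym (0≤p⇒∣p∣≡p 0≤p))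
... | inj₂ p≤0 = ≤-trans p≤0 (0≤∣p∣ p)

-- Unnormalised rationals multiply componentwise, so the proof passes through them to avoid the gcd.
/-* : ∀ x y m n .{{_ : NonZero m}} .{{_ : NonZero n}} →
      _/_ (x ℤ.* y) (m ℕ.* n) {{ℕ.m*n≢0 m n}} ≡ (x / m) * (y / n)
/-* x y (suc m) (suc n) = toℚᵘ-injective (ℚᵘ.≃-trans
  (toℚᵘ-fromℚᵘ (ℚᵘ.mkℚᵘ (x ℤ.* y) (n ℕ.+ m ℕ.* suc n)))
  (ℚᵘ.≃-trans
    (ℚᵘ.*-cong (ℚᵘ.≃-sym (toℚᵘ-fromℚᵘ (ℚᵘ.mkℚᵘ x m))) (ℚᵘ.≃-sym (toℚᵘ-fromℚᵘ (ℚᵘ.mkℚᵘ y n))))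
    (ℚᵘ.≃-sym (toℚᵘ-homo-* (x / suc m) (y / suc n)))))

-- Opacity keeps normalised fractions from unfolding; the lemmas of this block are the interface to
-- `ι` and `inv`.
opaque
  ι : ℕ → ℚ
  ι n = (ℤ.+ n) / 1

  inv : ℕ → ℚ
  inv n = 1ℤ / suc n

  inv-def : ∀ n → inv n ≡ 1ℤ / suc n
  inv-def n = refl

  ι-zero : ι 0 ≡ 0ℚ
  ι-zero = refl

  ι-suc : ∀ n → ι (suc n) ≡ 1ℚ + ι n
  ι-suc n = toℚᵘ-injective (ℚᵘ.≃-trans
    (ℚᵘ.≃-trans (toℚᵘ-fromℚᵘ (ℚᵘ.mkℚᵘ (ℤ.+ suc n) 0))
      (ℚᵘ.*≡* (cong (ℤ._* 1ℤ) (cong (λ t → 1ℤ ℤ.+ t) (sym (ℤ.*-identityʳ (ℤ.+ n)))))))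
    (ℚᵘ.≃-trans
      (ℚᵘ.+-cong (ℚᵘ.≃-refl {ℚᵘ.1ℚᵘ}) (ℚᵘ.≃-sym (toℚᵘ-fromℚᵘ (ℚᵘ.mkℚᵘ (ℤ.+ n) 0))))
      (ℚᵘ.≃-sym (toℚᵘ-homo-+ 1ℚ (ι n)))))

  0≤ι : ∀ n → 0ℚ ≤ ι n
  0≤ι n = nonNegative⁻¹ (ι n) {{normalize-nonNeg n 1}}

  0<ι : ∀ n → 0ℚ < ι (suc n)
  0<ι n = positive⁻¹ (ι (suc n)) {{normalize-pos (suc n) 1}}

  0<inv : ∀ n → 0ℚ < inv n
  0<inv n = positive⁻¹ (inv n) {{normalize-pos 1 (suc n)}}

  ι*inv : ∀ n → ι (suc n) * inv n ≡ 1ℚ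
  ι*inv n = trans (sym (/-* (ℤ.+ suc n) 1ℤ 1 (suc n)))
    (fromℚᵘ-cong {ℚᵘ.mkℚᵘ (ℤ.+ suc n ℤ.* 1ℤ) (n ℕ.+ 0)} {ℚᵘ.mkℚᵘ 1ℤ 0} (ℚᵘ.*≡* (trans
      (ℤ.*-identityʳ (ℤ.+ suc n ℤ.* 1ℤ)) (trans (ℤ.*-identityʳ (ℤ.+ suc n))
        (trans (cong (λ t → ℤ.+ suc t) (sym (ℕ.+-identityʳ n))) (sym (ℤ.*-identityˡ _)))))))

  archimedean : ∀ q → ∃ λ n → q ≤ ι n
  archimedean q@(mkℚ x m _) = ℤ.∣ x ∣ , toℚᵘ-cancel-≤ (ℚᵘ.≤-respʳ-≃
    (ℚᵘ.≃-sym (toℚᵘ-fromℚᵘ (ℚᵘ.mkℚᵘ (ℤ.+ ℤ.∣ x ∣) 0)))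
    (ℚᵘ.*≤* (ℤ.≤-trans (ℤ.≤-trans (ℤ.≤-reflexive (ℤ.*-identityʳ x)) (i≤∣i∣ x))
      (subst (ℤ.+ ℤ.∣ x ∣ ℤ.≤_) (ℤ.pos-* ℤ.∣ x ∣ (suc m)) (ℤ.+≤+ (ℕ.m≤m*n ℤ.∣ x ∣ (suc m)))))))
    where
    i≤∣i∣ : ∀ i → i ℤ.≤ ℤ.+ ℤ.∣ i ∣
    i≤∣i∣ (ℤ.+ n)      = ℤ.≤-refl
    i≤∣i∣ (ℤ.-[1+ n ]) = ℤ.-≤+

ι-mono : ∀ {m n} → m ℕ.≤ n → ι m ≤ ι n
ι-mono {n = n} ℕ.z≤n = subst (_≤ ι n) (sym ι-zero) (0≤ι n)
ι-mono {suc m} {suc n} (ℕ.s≤s m≤n) =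
  subst₂ _≤_ (sym (ι-suc m)) (sym (ι-suc n)) (+-monoʳ-≤ 1ℚ (ι-mono m≤n))

0≤inv : ∀ n → 0ℚ ≤ inv n
0≤inv n = <⇒≤ (0<inv n)

archimedean-* : ∀ C {ε} → 0ℚ < ε → ∃ λ n → C ≤ ι n * ε
archimedean-* C {ε} 0<ε with archimedean (C * 1/ε)
  where 1/ε = (1/ ε) {{pos⇒nonZero ε {{positive 0<ε}}}}
... | n , C/ε≤n = n , subst (_≤ ι n * ε)
  (trans (*-assoc C _ ε) (trans (cong (C *_) (*-inverseˡ ε {{pos⇒nonZero ε {{positive 0<ε}}}})) (*-identityʳ C)))
  (*-monoʳ-≤-nonNeg ε {{nonNegative (<⇒≤ 0<ε)}} C/ε≤n)

half : ℕ → ℚ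
half zero    = 1ℚ
half (suc n) = ½ * half n

0<half : ∀ n → 0ℚ < half n
0<half zero    = positive⁻¹ 1ℚ
0<half (suc n) = ½*-pos (0<half n)

0≤half : ∀ n → 0ℚ ≤ half n
0≤half n = <⇒≤ (0<half n)

half-suc≤ : ∀ n → half (suc n) ≤ half n
half-suc≤ n = ≤-by-diff
  (solve 1 (λ h → h :- con ½ :* h := con ½ :* h :- con 0ℚ) refl (half n)) (0≤half (suc n))

half-anti : ∀ {m n} → m ℕ.≤ n → half n ≤ half m
half-anti {n = zero}  ℕ.z≤n = ≤-refl
half-anti {n = suc n} ℕ.z≤n = ≤-trans (half-suc≤ n) (half-anti {n = n} ℕ.z≤n)
half-anti (ℕ.s≤s m≤n) = *-monoˡ-≤ 0≤½ (half-anti m≤n)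

ι*half≤1 : ∀ n → ι n * half n ≤ 1ℚ
ι*half≤1 zero    = subst (λ t → t * 1ℚ ≤ 1ℚ) (sym ι-zero) (nonNegative⁻¹ 1ℚ)
ι*half≤1 (suc n) = subst (λ t → t * half (suc n) ≤ 1ℚ) (sym (ι-suc n)) (≤-by-diff
  (solve 2 (λ m h → con 1ℚ :- (con 1ℚ :+ m) :* (con ½ :* h) :=
                    con ½ :* (con 1ℚ :+ con 1ℚ) :- con ½ :* (h :+ m :* h)) refl (ι n) (half n))
  (*-monoˡ-≤ 0≤½ (+-mono-≤ (half-anti {0} {n} ℕ.z≤n) (ι*half≤1 n))))

half→0 : ∀ {ε} → 0ℚ < ε → ∃ λ N → ∀ n → N ℕ.≤ n → half n < ε
half→0 {ε} 0<ε with archimedean-* 1ℚ 0<ε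
-- Passing from N to N + 1 makes the bound strict: (N + 1) 2^-(N+1) ≤ 1 ≤ N ε < (N + 1) ε.
... | N , 1≤Nε = suc N , λ n N<n → ≤-<-trans (half-anti N<n)
  (*-cancelˡ-<-nonNeg (ι (suc N)) {{nonNegative (0≤ι (suc N))}}
    (≤-<-trans (ι*half≤1 (suc N))
      (≤-<-trans 1≤Nε (<-by-diff
        (trans (cong (λ t → t * ε - ι N * ε) (ι-suc N))
          (solve 2 (λ m e → (con 1ℚ :+ m) :* e :- m :* e := e :- con 0ℚ) refl (ι N) ε)) 0<ε))))

-- The two operators and their compositions.

Seq : Set
Seq = ℕ → ℚ

σ : Seq → Seq
σ f zero    = f 0
σ f (suc i) = σ f i + f (suc i)

mean damp : Seq → Seq
mean f i = inv i * σ f i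
damp f i = inv i * f i

δ 𝟏 : Seq
δ zero    = 1ℚ
δ (suc _) = 0ℚ
𝟏 _       = 1ℚ

-- The index p stands for an entry p + 1 of k; coblock acts on the side of the
-- summands n₁^-k₁ ∑ …, block on the transformed side.

block coblock : ℕ → Seq → Seq
block zero    f = damp f
block (suc p) f = mean (block p f)
coblock zero    f = mean f
coblock (suc p) f = damp (coblock p f)

act coact : List ℕ → Seq → Seq
act []         f = f
act (p ∷ ps)   f = block p (act ps f)
coact []       f = f
coact (p ∷ ps) f = coblock p (coact ps f)

-- Serves for the order, the strict order and the bounds 0 and 1, all of which both operators
-- preserve.
module _ (R : Seq → Seq → Set)
         (R-mean : ∀ {f g} → R f g → R (mean f) (mean g))
         (R-damp : ∀ {f g} → R f g → R (damp f) (damp g)) where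

  block-rel : ∀ p {f g} → R f g → R (block p f) (block p g)
  block-rel zero    r = R-damp r
  block-rel (suc p) r = R-mean (block-rel p r)

  act-rel : ∀ ps {f g} → R f g → R (act ps f) (act ps g)
  act-rel []       r = r
  act-rel (p ∷ ps) r = block-rel p (act-rel ps r)

-- The variant for relations under which the two operators trade places, as for duality.
module _ (R : Seq → Seq → Set)
         (R-mean : ∀ {f g} → R f g → R (mean f) (damp g))
         (R-damp : ∀ {f g} → R f g → R (damp f) (mean g)) where

  block-corel : ∀ p {f g} → R f g → R (block p f) (coblock p g)
  block-corel zero    r = R-damp r
  block-corel (suc p) r = R-mean (block-corel p r)

  act-corel : ∀ ps {f g} → R f g → R (act ps f) (coact ps g)
  act-corel []       r = r
  act-corel (p ∷ ps) r = block-corel p (act-corel ps r)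

-- Binomial duality.

-- For moment i j = ∫ xʲ (1 - x)ⁱ dμ these are the moments at 1 - x and at x of the
-- same measure μ; thus g is the binomial transform of f.

record Dual (f g : Seq) : Set where
  field
    moment : ℕ → ℕ → ℚ
    pascal : ∀ i j → moment i j ≡ moment i (suc j) + moment (suc i) j
    c≥0    : ∀ i j → 0ℚ ≤ moment i j
    col    : ∀ i → moment i 0 ≡ f i
    row    : ∀ j → moment 0 j ≡ g j

Dual-sym : ∀ {f g} → Dual f g → Dual g f
Dual-sym D = record
  { moment = λ i j → moment j i
  ; pascal = λ i j → trans (pascal j i) (+-comm (moment j (suc i)) (moment (suc j) i))
  ; c≥0    = λ i j → c≥0 j i
  ; col    = row
  ; row    = col
  }
  where open Dual D

-- With f i = ∫ xʲ (1 - x)ⁱ dμ, `avg j f i` is m i j = ∫∫ (ux)ʲ (1 - ux)ⁱ du dμ for u in [0,1].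
-- Integration by parts in u gives (i + j + 1) m i j = f i + i m (i - 1) j, and `pre` is the last
-- summand.
avg pre : ℕ → Seq → Seq
avg j f i = inv (j ℕ.+ i) * (f i + pre j f i)
pre j f zero    = 0ℚ
pre j f (suc i) = ι (suc i) * avg j f i

ι*inv* : ∀ n x → ι (suc n) * (inv n * x) ≡ x
ι*inv* n x = trans (sym (*-assoc (ι (suc n)) (inv n) x))
  (trans (cong (_* x) (ι*inv n)) (*-identityˡ x))

-- Mutual induction on i. Clearing the denominator i + j + 2 reduces `avg-pascal` at i to
-- `pre-pascal` at i, while `pre-pascal` at i + 1 is `avg-pascal` at i times i + 1.
pre-pascal : ∀ (c : ℕ → ℕ → ℚ) → (∀ i j → c i j ≡ c i (suc j) + c (suc i) j) → ∀ i j →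
  pre (suc j) (λ i → c i (suc j)) i ≡ pre j (λ i → c i j) i - ι i * avg j (λ i → c i j) i
avg-pascal : ∀ (c : ℕ → ℕ → ℚ) → (∀ i j → c i j ≡ c i (suc j) + c (suc i) j) → ∀ i j →
  avg j (λ i → c i j) i ≡ avg (suc j) (λ i → c i (suc j)) i + avg j (λ i → c i j) (suc i)

pre-pascal c pascal zero j =
  sym (trans (cong (λ t → 0ℚ - t * avg j (λ i → c i j) 0) ι-zero)
    (solve 1 (λ x → con 0ℚ :- con 0ℚ :* x := con 0ℚ) refl (avg j (λ i → c i j) 0)))
pre-pascal c pascal (suc i) j = trans
  (solve 3 (λ n y z → n :* y := n :* (y :+ z) :- n :* z) refl
    (ι (suc i)) (avg (suc j) (λ i → c i (suc j)) i) (avg j (λ i → c i j) (suc i)))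
  (cong (λ t → ι (suc i) * t - ι (suc i) * avg j (λ i → c i j) (suc i))
    (sym (avg-pascal c pascal i j)))

avg-pascal c pascal i j = *-cancelˡ-≡ (0<ι (suc (j ℕ.+ i))) (begin
  ι (suc (suc (j ℕ.+ i))) * z
    ≡⟨ cong (_* z) (ι-suc (suc (j ℕ.+ i))) ⟩
  (1ℚ + ι (suc (j ℕ.+ i))) * z
    ≡⟨ solve 2 (λ n z → (con 1ℚ :+ n) :* z := n :* z :+ z) refl (ι (suc (j ℕ.+ i))) z ⟩
  ι (suc (j ℕ.+ i)) * z + z
    ≡⟨ cong (_+ z) (ι*inv* (j ℕ.+ i) (c i j + q)) ⟩
  (c i j + q) + z
    ≡⟨ cong (λ t → (t + q) + z) (pascal i j) ⟩
  ((c i (suc j) + c (suc i) j) + q) + z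
    ≡⟨ solve 5 (λ a b q z n → ((a :+ b) :+ q) :+ z :=
         (a :+ (q :- n :* z)) :+ (b :+ (con 1ℚ :+ n) :* z)) refl
         (c i (suc j)) (c (suc i) j) q z (ι i) ⟩
  (c i (suc j) + (q - ι i * z)) + (c (suc i) j + (1ℚ + ι i) * z)
    ≡⟨ cong₂ (λ s t → (c i (suc j) + s) + (c (suc i) j + t * z))
         (sym (pre-pascal c pascal i j)) (sym (ι-suc i)) ⟩
  (c i (suc j) + pre (suc j) (λ i → c i (suc j)) i) + (c (suc i) j + ι (suc i) * z)
    ≡⟨ cong₂ _+_ (sym (ι*inv* (suc (j ℕ.+ i)) (c i (suc j) + pre (suc j) (λ i → c i (suc j)) i)))
         (sym (ι*inv* (suc (j ℕ.+ i)) (c (suc i) j + ι (suc i) * z))) ⟩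
  ι (suc (suc (j ℕ.+ i))) * w + ι (suc (suc (j ℕ.+ i))) * (inv (suc (j ℕ.+ i)) * (c (suc i) j + ι (suc i) * z))
    ≡⟨ cong (λ t → ι (suc (suc (j ℕ.+ i))) * w + ι (suc (suc (j ℕ.+ i))) * (inv t * (c (suc i) j + ι (suc i) * z)))
         (sym (ℕ.+-suc j i)) ⟩
  ι (suc (suc (j ℕ.+ i))) * w + ι (suc (suc (j ℕ.+ i))) * avg j (λ i → c i j) (suc i)
    ≡⟨ sym (*-distribˡ-+ (ι (suc (suc (j ℕ.+ i)))) w (avg j (λ i → c i j) (suc i))) ⟩
  ι (suc (suc (j ℕ.+ i))) * (w + avg j (λ i → c i j) (suc i)) ∎)
  where
  open ≡-Reasoning
  z q w : ℚ
  z = avg j (λ i → c i j) i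
  q = pre j (λ i → c i j) i
  w = avg (suc j) (λ i → c i (suc j)) i

avg-nonNeg : ∀ j {f} → (∀ i → 0ℚ ≤ f i) → ∀ i → 0ℚ ≤ avg j f i
avg-nonNeg j f≥0 zero    = 0≤* (0≤inv (j ℕ.+ 0)) (0≤+ (f≥0 0) ≤-refl)
avg-nonNeg j f≥0 (suc i) = 0≤* (0≤inv (j ℕ.+ suc i))
  (0≤+ (f≥0 (suc i)) (0≤* (0≤ι (suc i)) (avg-nonNeg j f≥0 i)))

σ-cong : ∀ {f g} → (∀ i → f i ≡ g i) → ∀ i → σ f i ≡ σ g i
σ-cong f≡g zero    = f≡g 0
σ-cong f≡g (suc i) = cong₂ _+_ (σ-cong f≡g i) (f≡g (suc i))

-- For j = 0 the recursion is (i + 1) m i = f i + i m (i - 1), which the running mean solves.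
avg₀≡mean : ∀ f i → avg 0 f i ≡ mean f i
pre₀+≡σ : ∀ f i → f i + pre 0 f i ≡ σ f i

avg₀≡mean f i = cong (inv i *_) (pre₀+≡σ f i)
pre₀+≡σ f zero    = +-identityʳ (f 0)
pre₀+≡σ f (suc i) = trans
  (cong (λ t → f (suc i) + ι (suc i) * t) (avg₀≡mean f i))
  (trans (cong (f (suc i) +_) (ι*inv* i (σ f i))) (+-comm (f (suc i)) (σ f i)))

-- The array built by `avg` has the running mean as its column j = 0 and, since `pre` vanishes at i
-- = 0, the damped sequence as its row.
Dual-mean : ∀ {f g} → Dual f g → Dual (mean f) (damp g)
Dual-mean {f} {g} D = record
  { moment = λ i j → avg j (λ i → moment i j) i
  ; pascal = avg-pascal moment pascal
  ; c≥0    = λ i j → avg-nonNeg j (λ i → c≥0 i j) i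
  ; col    = λ i → trans (avg₀≡mean (λ i → moment i 0) i) (cong (inv i *_) (σ-cong col i))
  ; row    = λ j → cong₂ (λ m x → inv m * x) (ℕ.+-identityʳ j)
               (trans (+-identityʳ (moment 0 j)) (row j))
  }
  where open Dual D

Dual-damp : ∀ {f g} → Dual f g → Dual (damp f) (mean g)
Dual-damp D = Dual-sym (Dual-mean (Dual-sym D))

-- These are the moments of the unit mass at x = 0.
Dual-𝟏-δ : Dual 𝟏 δ
Dual-𝟏-δ = record
  { moment = λ i → δ
  ; pascal = λ { i zero → refl ; i (suc j) → refl }
  ; c≥0    = λ { i zero → nonNegative⁻¹ 1ℚ ; i (suc j) → ≤-refl }
  ; col    = λ i → refl
  ; row    = λ j → refl
  }

-- Alternating sums and Euler's transformation.

sgn : ℕ → ℚ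
sgn zero    = 1ℚ
sgn (suc n) = - sgn n

alt : ℕ → Seq → ℚ
alt zero    a = 0ℚ
alt (suc N) a = alt N a + sgn N * a N

-- Horner form of Σ 2^-(i+1) b i over i < M.
L : ℕ → Seq → ℚ
L zero    b = 0ℚ
L (suc M) b = ½ * (b 0 + L M (b ∘ suc))

alt-suc : ∀ N a → alt (suc N) a ≡ a 0 - alt N (a ∘ suc)
alt-suc zero    a = solve 1 (λ x → con 0ℚ :+ con 1ℚ :* x := x :- con 0ℚ) refl (a 0)
alt-suc (suc N) a = trans (cong (_+ sgn (suc N) * a (suc N)) (alt-suc N a))
  (solve 4 (λ x y s z → (x :- y) :+ (:- s) :* z := x :- (y :+ s :* z)) refl
    (a 0) (alt N (a ∘ suc)) (sgn N) (a (suc N)))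

alt-- : ∀ N {f g h : Seq} → (∀ j → f j ≡ g j - h j) → alt N f ≡ alt N g - alt N h
alt-- zero    eq = refl
alt-- (suc N) {f} {g} {h} eq = trans (cong₂ (λ s t → s + sgn N * t) (alt-- N eq) (eq N))
  (solve 5 (λ p q s x y → (p :- q) :+ s :* (x :- y) := (p :+ s :* x) :- (q :+ s :* y)) refl
    (alt N g) (alt N h) (sgn N) (g N) (h N))

sgn*-bounds : ∀ n {x} → 0ℚ ≤ x → sgn n * x ≤ x × - (sgn n * x) ≤ x
sgn*-bounds zero {x} 0≤x = ≤-reflexive (*-identityˡ x) ,
  ≤-trans (≤-by-diff (solve 1 (λ x → con 0ℚ :- :- (con 1ℚ :* x) := x :- con 0ℚ) refl x) 0≤x) 0≤x
sgn*-bounds (suc n) {x} 0≤x with sgn*-bounds n 0≤x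
... | ≤x , -≤x = subst (_≤ x) (neg-distribˡ-* (sgn n) x) -≤x ,
  subst (_≤ x) (solve 2 (λ s x → s :* x := :- ((:- s) :* x)) refl (sgn n) x) ≤x

-- Leibniz: the sum is a 0 minus a sum of the same kind, which lies between 0 and a 1.
alt-bounds : ∀ N {a} → (∀ j → a (suc j) ≤ a j) → (∀ j → 0ℚ ≤ a j) →
             0ℚ ≤ alt N a × alt N a ≤ a 0
alt-bounds zero    a↓ a≥0 = ≤-refl , a≥0 0
alt-bounds (suc N) {a} a↓ a≥0 with alt-bounds N (λ j → a↓ (suc j)) (λ j → a≥0 (suc j))
... | 0≤ , ≤a₁ rewrite alt-suc N a =
  ≤-by-diff (solve 2 (λ x y → (x :- y) :- con 0ℚ := x :- y) refl (a 0) (alt N (a ∘ suc)))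
    (≤-trans ≤a₁ (a↓ 0)) ,
  ≤-by-diff (solve 2 (λ x y → x :- (x :- y) := y :- con 0ℚ) refl (a 0) (alt N (a ∘ suc))) 0≤

euler-base : ∀ {t c n b} → 0ℚ ≤ t → t ≤ c → 0ℚ ≤ n → c ≤ b →
  t - 0ℚ ≤ n + 1ℚ * b × 0ℚ - t ≤ n + 1ℚ * b
euler-base {t} {c} {n} {b} 0≤t t≤c 0≤n c≤b =
  ≤-by-diff (solve 3 (λ t n b → (n :+ con 1ℚ :* b) :- (t :- con 0ℚ) := (b :+ n) :- (t :+ con 0ℚ)) refl t n b)
    (+-mono-≤ (≤-trans t≤c c≤b) 0≤n) ,
  ≤-by-diff (solve 3 (λ t n b →
      (n :+ con 1ℚ :* b) :- (con 0ℚ :- t) := ((t :+ b) :+ n) :- (con 0ℚ :+ con 0ℚ)) refl t n b)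
    (+-mono-≤ (0≤+ 0≤t (≤-trans 0≤t (≤-trans t≤c c≤b))) 0≤n)

-- As 2 t = u - s + c, the new error is half of (u - l) - s; the average of n₁ and n is at most n,
-- so the endpoint term does not grow.
euler-step : ∀ {t u s l c n n₁ h b} → u ≡ (t + s) + t - c → s ≤ n → - s ≤ n → n₁ ≤ n →
  u - l ≤ n₁ + h * b → l - u ≤ n₁ + h * b →
  t - ½ * (c + l) ≤ n + (½ * h) * b × ½ * (c + l) - t ≤ n + (½ * h) * b
euler-step {t} {u} {s} {l} {c} {n} {n₁} {h} {b} refl s≤n -s≤n n₁≤n ≤up ≤low =
  ≤-by-diff
    (trans (cong (λ x → (n + x) - (t - ½ * (c + l))) (*-assoc ½ h b))
      (solve 7 (λ t s l c n n₁ hb → (n :+ con ½ :* hb) :- (t :- con ½ :* (c :+ l)) :=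
          con ½ :* ((n₁ :+ hb) :+ n :+ n) :-
          con ½ :* ((((t :+ s) :+ t :- c) :- l) :+ :- s :+ n₁)) refl t s l c n n₁ (h * b)))
    (*-monoˡ-≤ 0≤½ (+-mono-≤ (+-mono-≤ ≤up -s≤n) n₁≤n)) ,
  ≤-by-diff
    (trans (cong (λ x → (n + x) - (½ * (c + l) - t)) (*-assoc ½ h b))
      (solve 7 (λ t s l c n n₁ hb → (n :+ con ½ :* hb) :- (con ½ :* (c :+ l) :- t) :=
          con ½ :* ((n₁ :+ hb) :+ n :+ n) :-
          con ½ :* ((l :- ((t :+ s) :+ t :- c)) :+ s :+ n₁)) refl t s l c n n₁ (h * b)))
    (*-monoˡ-≤ 0≤½ (+-mono-≤ (+-mono-≤ ≤low s≤n) n₁≤n))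

-- Pascal's rule gives 2 alt N (c 0) = c 0 0 + alt N (c 1) ± c 0 N.

euler : ∀ N M (c : ℕ → ℕ → ℚ) → (∀ i j → c i j ≡ c i (suc j) + c (suc i) j) →
  (∀ i j → 0ℚ ≤ c i j) → ∀ {B} → c 0 0 ≤ B →
  alt N (c 0) - L M (λ i → c i 0) ≤ c 0 N + half M * B ×
  L M (λ i → c i 0) - alt N (c 0) ≤ c 0 N + half M * B
euler N zero c pascal c≥0 {B} c≤B = euler-base {n = c 0 N} {B} (proj₁ T-bounds) (proj₂ T-bounds) (c≥0 0 N) c≤B
  where
  T-bounds = alt-bounds N {c 0} (λ j → ≤-by-diff (trans (cong (_- c 0 (suc j)) (pascal 0 j))
    (solve 2 (λ x y → (x :+ y) :- x := y :- con 0ℚ) refl (c 0 (suc j)) (c 1 j))) (c≥0 1 j))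
    (c≥0 0)
euler N (suc M) c pascal c≥0 {B} c≤B = euler-step {t} {u} {s} {L M (λ i → c (suc i) 0)}
  {c 0 0} {c 0 N} {c 1 N} {half M} {B} u-eq
  (proj₁ s-bounds) (proj₂ s-bounds) (c₁≤c₀ N) (proj₁ ih) (proj₂ ih)
  where
  t u s : ℚ
  t = alt N (c 0)
  u = alt N (c 1)
  s = sgn N * c 0 N
  c₁≤c₀ : ∀ j → c 1 j ≤ c 0 j
  c₁≤c₀ j = ≤-by-diff (trans (cong (_- c 1 j) (pascal 0 j))
    (solve 2 (λ x y → (x :+ y) :- y := x :- con 0ℚ) refl (c 0 (suc j)) (c 1 j))) (c≥0 0 (suc j))
  s-bounds = sgn*-bounds N (c≥0 0 N)
  -- The bound B stays fixed, as the corner c 1 0 of the shifted array is at most c 0 0.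
  ih = euler N M (λ i → c (suc i)) (λ i → pascal (suc i)) (λ i → c≥0 (suc i)) (≤-trans (c₁≤c₀ 0) c≤B)
  shift : alt N (c 0 ∘ suc) ≡ t - u
  shift = alt-- N (λ j → trans
    (solve 2 (λ x y → x := (x :+ y) :- y) refl (c 0 (suc j)) (c 1 j))
    (cong (_- c 1 j) (sym (pascal 0 j))))
  u-eq : u ≡ (t + s) + t - c 0 0
  u-eq = trans (solve 3 (λ t u c → u := (c :- (t :- u)) :+ t :- c) refl t u (c 0 0))
    (cong (λ x → x + t - c 0 0)
      (sym (trans (alt-suc N (c 0)) (cong (λ x → c 0 0 - x) shift))))

-- Null sequences.

-- An upper bound suffices, as the sequences concerned are nonnegative.
Vanish : Seq → Set
Vanish a = ∀ {ε} → 0ℚ < ε → ∃ λ N → ∀ n → N ℕ.≤ n → a n ≤ ε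

inv*≤ : ∀ n {x} → 0ℚ ≤ x → inv n * x ≤ x
inv*≤ n {x} 0≤x = *-cancelˡ-≤ (0<ι n) (≤-by-diff
  (trans (cong (λ t → ι (suc n) * x - t) (ι*inv* n x))
    (trans (cong (λ t → t * x - x) (ι-suc n))
      (solve 2 (λ m x → (con 1ℚ :+ m) :* x :- x := m :* x :- con 0ℚ) refl (ι n) x)))
  (0≤* (0≤ι n) 0≤x))

Vanish-damp : ∀ {a} → (∀ n → 0ℚ ≤ a n) → Vanish a → Vanish (damp a)
Vanish-damp a≥0 van 0<ε with van 0<ε
... | N , a≤ε = N , λ n N≤n → ≤-trans (inv*≤ n (a≥0 n)) (a≤ε n N≤n)

σ-tail : ∀ {f N ε} → (∀ n → N ℕ.≤ n → f n ≤ ε) → ∀ d → σ f (d ℕ.+ N) ≤ σ f N + ι d * ε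
σ-tail {f} {N} {ε} f≤ε zero = ≤-reflexive
  (trans (solve 2 (λ x e → x := x :+ con 0ℚ :* e) refl (σ f N) ε)
         (cong (λ t → σ f N + t * ε) (sym ι-zero)))
σ-tail {f} {N} {ε} f≤ε (suc d) = ≤-trans
  (+-mono-≤ (σ-tail f≤ε d) (f≤ε (suc d ℕ.+ N) (ℕ.m≤n+m N (suc d))))
  (≤-reflexive (trans
    (solve 3 (λ x m e → x :+ m :* e :+ e := x :+ (con 1ℚ :+ m) :* e) refl (σ f N) (ι d) ε)
    (cong (λ t → σ f N + t * ε) (sym (ι-suc d)))))

-- Cesàro's argument: from N on the terms are at most ε/2, and from K on the initial sum `σ a N` is
-- at most n ε/2.
Vanish-mean : ∀ {a} → Vanish a → Vanish (mean a)
Vanish-mean {a} van {ε} 0<ε = N ℕ.⊔ K , bound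
  where
  N K : ℕ
  N = proj₁ (van (½*-pos 0<ε))
  K = proj₁ (archimedean-* (σ a N) (½*-pos 0<ε))
  a≤ : ∀ n → N ℕ.≤ n → a n ≤ ½ * ε
  a≤ = proj₂ (van (½*-pos 0<ε))
  σN≤ : σ a N ≤ ι K * (½ * ε)
  σN≤ = proj₂ (archimedean-* (σ a N) (½*-pos 0<ε))
  bound : ∀ n → N ℕ.⊔ K ℕ.≤ n → mean a n ≤ ε
  bound n n≥ = *-cancelˡ-≤ (0<ι n) (subst (_≤ ι (suc n) * ε) (sym (ι*inv* n (σ a n)))
    (begin
      σ a n
        ≡⟨ cong (σ a) (sym (ℕ.m∸n+n≡m N≤n)) ⟩
      σ a (n ℕ.∸ N ℕ.+ N)
        ≤⟨ σ-tail a≤ (n ℕ.∸ N) ⟩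
      σ a N + ι (n ℕ.∸ N) * (½ * ε)
        ≤⟨ +-mono-≤ (≤-trans σN≤ (scale (ι-mono K≤n))) (scale (ι-mono (ℕ.m∸n≤m n N))) ⟩
      ι n * (½ * ε) + ι n * (½ * ε)
        ≡⟨ solve 2 (λ m e → m :* (con ½ :* e) :+ m :* (con ½ :* e) := m :* e) refl (ι n) ε ⟩
      ι n * ε
        ≤⟨ *-monoʳ-≤-nonNeg ε {{nonNegative (<⇒≤ 0<ε)}} (ι-mono (ℕ.n≤1+n n)) ⟩
      ι (suc n) * ε ∎))
    where
    open ≤-Reasoning
    N≤n = ℕ.m⊔n≤o⇒m≤o N K n≥
    K≤n = ℕ.m⊔n≤o⇒n≤o N K n≥
    scale : ∀ {p q} → p ≤ q → p * (½ * ε) ≤ q * (½ * ε)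
    scale = *-monoʳ-≤-nonNeg (½ * ε) {{nonNegative (<⇒≤ (½*-pos 0<ε))}}

Vanish-δ : Vanish δ
Vanish-δ 0<ε = 1 , λ { (suc n) _ → <⇒≤ 0<ε }

-- The nested sums in terms of the operators.

∑≥-cong : ∀ r N {f g : Vec ℤ⁺ r → ℚ} → (∀ ns → f ns ≡ g ns) → ∑≥ r N f ≡ ∑≥ r N g
∑≥-cong zero    N       f≡g = f≡g []
∑≥-cong (suc r) zero    f≡g = refl
∑≥-cong (suc r) (suc N) f≡g =
  cong₂ _+_ (∑≥-cong (suc r) N f≡g) (∑≥-cong r (suc N) (λ ns → f≡g _))

∑≥-*ˡ : ∀ r N x (f : Vec ℤ⁺ r → ℚ) → ∑≥ r N (λ ns → x * f ns) ≡ x * ∑≥ r N f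
∑≥-*ˡ zero    N       x f = refl
∑≥-*ˡ (suc r) zero    x f = sym (*-zeroʳ x)
∑≥-*ˡ (suc r) (suc N) x f = trans
  (cong₂ _+_ (∑≥-*ˡ (suc r) N x f) (∑≥-*ˡ r (suc N) x (λ ns → f ((suc N , [ _ ]) ∷ ns))))
  (sym (*-distribˡ-+ x _ _))

exponents : (ℕ → ℤ⁺) → ℕ → ℕ
exponents k n = ℕ.pred (value (k n))

suc-exponents : ∀ k n → suc (exponents k n) ≡ value (k n)
suc-exponents k n with k n
... | v , [ v≢0 ] = ℕ.suc-pred v {{v≢0}}

1/-cong : ∀ {m n} .{{_ : NonZero m}} .{{_ : NonZero n}} → m ≡ n → 1ℤ / m ≡ 1ℤ / n
1/-cong refl = refl

1/^ : ℕ → ℕ → ℚ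
1/^ N v = _/_ 1ℤ (suc N ℕ.^ v) {{ℕ.m^n≢0 (suc N) v}}

-- Index N stands for n₁ = N + 1; `mean` and each of the p dampings contribute one factor 1/n₁.
coblock≡ : ∀ p f N → coblock p f N ≡ 1/^ N (suc p) * σ f N
coblock≡ zero    f N = cong (_* σ f N) (trans (inv-def N)
  (1/-cong {n = suc N ℕ.^ 1} {{_}} {{ℕ.m^n≢0 (suc N) 1}} (sym (ℕ.*-identityʳ (suc N)))))
coblock≡ (suc p) f N = trans (cong₂ _*_ (inv-def N) (coblock≡ p f N))
  (trans (sym (*-assoc (1ℤ / suc N) (1/^ N (suc p)) (σ f N)))
    (cong (_* σ f N) (sym (/-* 1ℤ 1ℤ (suc N) (suc N ℕ.^ suc p) {{_}} {{ℕ.m^n≢0 (suc N) (suc p)}}))))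

recip : ∀ {r} → (ℕ → ℤ⁺) → Vec ℤ⁺ r → ℚ
recip k ns = _/_ 1ℤ (denom k ns) {{denom-nonZero k ns}}

recip-∷ : ∀ {r} k N (ns : Vec ℤ⁺ r) →
  recip k ((suc N , [ _ ]) ∷ ns) ≡ 1/^ N (value (k 0)) * recip (k ∘ suc) ns
recip-∷ k N ns = /-* 1ℤ 1ℤ (suc N ℕ.^ value (k 0)) (denom (k ∘ suc) ns)
  {{ℕ.m^n≢0 (suc N) (value (k 0))}} {{denom-nonZero (k ∘ suc) ns}}

σ-δ : ∀ N → σ δ N ≡ 1ℚ
σ-δ zero    = refl
σ-δ (suc N) = trans (+-identityʳ (σ δ N)) (σ-δ N)

a-side : (ℕ → ℤ⁺) → ℕ → Seq
a-side k r = coact (applyUpTo (exponents k) r) δ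

-- Mutual induction along `∑≥`. The partial sums of δ are all 1, the empty product at depth 0;
-- fixing the outer variable at N + 1 leaves its power times an inner sum, which is one `coblock`.
∑≥-recip : ∀ r N k → ∑≥ r (suc N) (recip k) ≡ σ (a-side k r) N
∑≥-recip-head : ∀ r N k → ∑≥ r (suc N) (λ ns → recip k ((suc N , [ _ ]) ∷ ns)) ≡ a-side k (suc r) N

∑≥-recip zero    N       k = sym (σ-δ N)
∑≥-recip (suc r) zero    k = trans (+-identityˡ _) (∑≥-recip-head r zero k)
∑≥-recip (suc r) (suc N) k = cong₂ _+_ (∑≥-recip (suc r) N k) (∑≥-recip-head r (suc N) k)

∑≥-recip-head r N k = begin
  ∑≥ r (suc N) (λ ns → recip k ((suc N , [ _ ]) ∷ ns))
    ≡⟨ ∑≥-cong r (suc N) (recip-∷ k N) ⟩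
  ∑≥ r (suc N) (λ ns → 1/^ N (value (k 0)) * recip (k ∘ suc) ns)
    ≡⟨ ∑≥-*ˡ r (suc N) (1/^ N (value (k 0))) (recip (k ∘ suc)) ⟩
  1/^ N (value (k 0)) * ∑≥ r (suc N) (recip (k ∘ suc))
    ≡⟨ cong₂ (λ v x → 1/^ N v * x) (sym (suc-exponents k 0)) (∑≥-recip r N (k ∘ suc)) ⟩
  1/^ N (suc (exponents k 0)) * σ (a-side (k ∘ suc) r) N
    ≡⟨ sym (coblock≡ (exponents k 0) (a-side (k ∘ suc) r) N) ⟩
  a-side k (suc r) N ∎
  where open ≡-Reasoning

sgn≡ : ∀ n → (-1ℤ ℤ.^ n) / 1 ≡ sgn n
sgn≡ zero    = refl
sgn≡ (suc n) = trans (/-* -1ℤ (-1ℤ ℤ.^ n) 1 1) (trans (cong ((-1ℤ / 1) *_) (sgn≡ n))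
  (solve 1 (λ s → con (- 1ℚ) :* s := :- s) refl (sgn n)))

term≡ : ∀ {r} k N (ns : Vec ℤ⁺ r) →
  term k ((suc N , [ _ ]) ∷ ns) ≡ sgn N * recip k ((suc N , [ _ ]) ∷ ns)
term≡ k N ns = trans (step d {{nz}}) (cong (_* _/_ 1ℤ d {{nz}}) (sgn≡ N))
  where
  d = denom k ((suc N , [ _ ]) ∷ ns)
  nz = denom-nonZero k ((suc N , [ _ ]) ∷ ns)
  step : ∀ d .{{_ : NonZero d}} → (-1ℤ ℤ.^ N) / d ≡ ((-1ℤ ℤ.^ N) / 1) * (1ℤ / d)
  step d = trans (/-cong {p₁ = -1ℤ ℤ.^ N} {q₁ = d} {{_}} {{ℕ.m*n≢0 1 d}}
      (sym (ℤ.*-identityʳ (-1ℤ ℤ.^ N))) (sym (ℕ.*-identityˡ d)))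
    (/-* (-1ℤ ℤ.^ N) 1ℤ 1 d)

∑≥-term : ∀ r N k → ∑≥ (suc r) N (term k) ≡ alt N (a-side k (suc r))
∑≥-term r zero    k = refl
∑≥-term r (suc N) k = cong₂ _+_ (∑≥-term r N k) (begin
  ∑≥ r (suc N) (λ ns → term k ((suc N , [ _ ]) ∷ ns))
    ≡⟨ ∑≥-cong r (suc N) (term≡ k N) ⟩
  ∑≥ r (suc N) (λ ns → sgn N * recip k ((suc N , [ _ ]) ∷ ns))
    ≡⟨ ∑≥-*ˡ r (suc N) (sgn N) (λ ns → recip k ((suc N , [ _ ]) ∷ ns)) ⟩
  sgn N * ∑≥ r (suc N) (λ ns → recip k ((suc N , [ _ ]) ∷ ns))
    ≡⟨ cong (sgn N *_) (∑≥-recip-head r N k) ⟩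
  sgn N * a-side k (suc r) N ∎)
  where open ≡-Reasoning

-- Pointwise order.

infix 4 _≼_ _≺_

-- Both operators fix the value at index 0, where δ and 𝟏 agree, so index 1 is the first that can
-- tell images apart; strictness there survives both operators.
_≼_ _≺_ : Seq → Seq → Set
b ≼ c = ∀ i → b i ≤ c i
b ≺ c = b ≼ c × b 1 < c 1

≼-trans : ∀ {b c d} → b ≼ c → c ≼ d → b ≼ d
≼-trans b≼c c≼d i = ≤-trans (b≼c i) (c≼d i)

≼-≺-trans : ∀ {b c d} → b ≼ c → c ≺ d → b ≺ d
≼-≺-trans b≼c (c≼d , c<d) = ≼-trans b≼c c≼d , ≤-<-trans (b≼c 1) c<d

≺-≼-trans : ∀ {b c d} → b ≺ c → c ≼ d → b ≺ d
≺-≼-trans (b≼c , b<c) c≼d = ≼-trans b≼c c≼d , <-≤-trans b<c (c≼d 1)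

σ-mono : ∀ {b c} → b ≼ c → σ b ≼ σ c
σ-mono b≼c zero    = b≼c 0
σ-mono b≼c (suc i) = +-mono-≤ (σ-mono b≼c i) (b≼c (suc i))

mean-mono : ∀ {b c} → b ≼ c → mean b ≼ mean c
mean-mono b≼c i = *-monoˡ-≤ (0≤inv i) (σ-mono b≼c i)

damp-mono : ∀ {b c} → b ≼ c → damp b ≼ damp c
damp-mono b≼c i = *-monoˡ-≤ (0≤inv i) (b≼c i)

mean-mono-≺ : ∀ {b c} → b ≺ c → mean b ≺ mean c
mean-mono-≺ (b≼c , b<c) = mean-mono b≼c , *-monoˡ-< (0<inv 1) (+-mono-≤-< (b≼c 0) b<c)

damp-mono-≺ : ∀ {b c} → b ≺ c → damp b ≺ damp c
damp-mono-≺ (b≼c , b<c) = damp-mono b≼c , *-monoˡ-< (0<inv 1) b<c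

act-mono : ∀ ps {b c} → b ≼ c → act ps b ≼ act ps c
act-mono = act-rel _≼_ mean-mono damp-mono

act-mono-≺ : ∀ ps {b c} → b ≺ c → act ps b ≺ act ps c
act-mono-≺ = act-rel _≺_ mean-mono-≺ damp-mono-≺

-- Images of δ and 𝟏, and the tiling.

σ-𝟏 : ∀ i → σ 𝟏 i ≡ ι (suc i)
σ-𝟏 zero    = sym (trans (ι-suc 0) (trans (cong (1ℚ +_) ι-zero) (+-identityʳ 1ℚ)))
σ-𝟏 (suc i) = trans (+-comm (σ 𝟏 i) 1ℚ) (trans (cong (1ℚ +_) (σ-𝟏 i)) (sym (ι-suc (suc i))))

mean-𝟏 : ∀ i → mean 𝟏 i ≡ 1ℚ
mean-𝟏 i = trans (cong (inv i *_) (σ-𝟏 i)) (trans (*-comm (inv i) (ι (suc i))) (ι*inv i))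

-- Both are 1/(i + 1). This makes neighbouring tiles abut: the top of one block is the bottom of the
-- next.
mean-δ≡damp-𝟏 : ∀ i → mean δ i ≡ damp 𝟏 i
mean-δ≡damp-𝟏 i = cong (inv i *_) (σ-δ i)

damp-δ : ∀ i → damp δ i ≡ δ i
damp-δ zero    = trans (*-identityʳ (inv 0)) (inv-def 0)
damp-δ (suc i) = *-zeroʳ (inv (suc i))

Unit : Seq → Set
Unit b = (∀ i → 0ℚ ≤ b i) × b ≼ 𝟏

σ-nonNeg : ∀ {b} → (∀ i → 0ℚ ≤ b i) → ∀ i → 0ℚ ≤ σ b i
σ-nonNeg b≥0 zero    = b≥0 0
σ-nonNeg b≥0 (suc i) = 0≤+ (σ-nonNeg b≥0 i) (b≥0 (suc i))

Unit-mean : ∀ {b} → Unit b → Unit (mean b)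
Unit-mean (b≥0 , b≤1) = (λ i → 0≤* (0≤inv i) (σ-nonNeg b≥0 i)) ,
  λ i → ≤-trans (mean-mono b≤1 i) (≤-reflexive (mean-𝟏 i))

Unit-damp : ∀ {b} → Unit b → Unit (damp b)
Unit-damp (b≥0 , b≤1) = (λ i → 0≤* (0≤inv i) (b≥0 i)) ,
  λ i → ≤-trans (inv*≤ i (b≥0 i)) (b≤1 i)

Unit-act : ∀ ps {b} → Unit b → Unit (act ps b)
Unit-act ps {b} = act-rel (λ f _ → Unit f) Unit-mean Unit-damp ps {b} {b}

Unit-𝟏 : Unit 𝟏
Unit-𝟏 = (λ _ → nonNegative⁻¹ 1ℚ) , λ _ → ≤-refl

Unit-δ : Unit δ
Unit-δ = (λ { zero → nonNegative⁻¹ 1ℚ ; (suc _) → ≤-refl }) ,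
  λ { zero → ≤-refl ; (suc _) → nonNegative⁻¹ 1ℚ }

-- The endpoints of the tiling of [δ , 𝟏] by the intervals [block p δ , block p 𝟏].

cut : ℕ → Seq
cut zero    = δ
cut (suc p) = mean (cut p)

-- The two sides agree pointwise because `damp` fixes δ; the equality is kept as two inequalities,
-- which `mean-mono` propagates.
block-δ≼cut : ∀ p → block p δ ≼ cut p
block-δ≼cut zero    i = ≤-reflexive (damp-δ i)
block-δ≼cut (suc p) = mean-mono (block-δ≼cut p)

cut≼block-δ : ∀ p → cut p ≼ block p δ
cut≼block-δ zero    i = ≤-reflexive (sym (damp-δ i))
cut≼block-δ (suc p) = mean-mono (cut≼block-δ p)

block-𝟏≼cut : ∀ p → block p 𝟏 ≼ cut (suc p)
block-𝟏≼cut zero    i = ≤-reflexive (sym (mean-δ≡damp-𝟏 i))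
block-𝟏≼cut (suc p) = mean-mono (block-𝟏≼cut p)

cut≼block-𝟏 : ∀ p → cut (suc p) ≼ block p 𝟏
cut≼block-𝟏 zero    i = ≤-reflexive (mean-δ≡damp-𝟏 i)
cut≼block-𝟏 (suc p) = mean-mono (cut≼block-𝟏 p)

Unit-cut : ∀ p → Unit (cut p)
Unit-cut zero    = Unit-δ
Unit-cut (suc p) = Unit-mean (Unit-cut p)

δ≼cut : ∀ p → δ ≼ cut p
δ≼cut zero    i = ≤-refl
δ≼cut (suc p) = ≼-trans δ≼mean (mean-mono (δ≼cut p))
  where
  δ≼mean : δ ≼ mean δ
  δ≼mean zero    = ≤-reflexive (sym (trans (*-identityʳ (inv 0)) (inv-def 0)))
  δ≼mean (suc i) = proj₁ (Unit-mean Unit-δ) (suc i)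

cut-mono : ∀ {p q} → p ℕ.≤ q → cut p ≼ cut q
cut-mono {q = q} ℕ.z≤n = δ≼cut q
cut-mono (ℕ.s≤s p≤q)   = mean-mono (cut-mono p≤q)

-- `mean` fixes 𝟏 and preserves strictness, so no tile reaches the right endpoint.
cut≺𝟏 : ∀ p → cut p ≺ 𝟏
cut≺𝟏 zero    = proj₂ Unit-δ , positive⁻¹ 1ℚ
cut≺𝟏 (suc p) = ≺-≼-trans (mean-mono-≺ (cut≺𝟏 p)) (λ i → ≤-reflexive (mean-𝟏 i))

-- Contraction.

-- The excess is weighted by i because both operators shrink that weight by a half, whereas `mean`
-- would leave a constant excess as it is.
Close : ℕ → Seq → Seq → Set
Close n b c = ∀ i → c i ≤ b i + half n * ι i

Close-pred : ∀ n {b c} → Close (suc n) b c → Close n b c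
Close-pred n {b} close i = ≤-trans (close i)
  (+-monoʳ-≤ (b i) (*-monoʳ-≤-nonNeg (ι i) {{nonNegative (0≤ι i)}} (half-suc≤ n)))

Close-mono : ∀ {m n b c} → m ℕ.≤ n → Close n b c → Close m b c
Close-mono {m} {n} {b} m≤n close i = ≤-trans (close i)
  (+-monoʳ-≤ (b i) (*-monoʳ-≤-nonNeg (ι i) {{nonNegative (0≤ι i)}} (half-anti m≤n)))

ι*-≤ : ∀ i {x y z} → x ≤ y + ι (suc i) * z → inv i * x ≤ inv i * y + z
ι*-≤ i {x} {y} {z} x≤ = subst (inv i * x ≤_)
  (trans (*-distribˡ-+ (inv i) y _) (cong (inv i * y +_)
    (trans (sym (*-assoc (inv i) (ι (suc i)) z)) (trans (cong (_* z)
      (trans (*-comm (inv i) (ι (suc i))) (ι*inv i))) (*-identityˡ z)))))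
  (*-monoˡ-≤ (0≤inv i) x≤)

-- Both operators halve the excess i, as its running mean is i / 2 and i / (i + 1) ≤ i / 2.

Close-mean : ∀ n {b c} → Close n b c → Close (suc n) (mean b) (mean c)
Close-mean n {b} {c} close i = ι*-≤ i (excess i)
  where
  excess : ∀ i → σ c i ≤ σ b i + ι (suc i) * (½ * half n * ι i)
  excess zero = subst (λ m → c 0 ≤ b 0 + ι 1 * (½ * half n * m)) (sym ι-zero)
    (≤-trans (subst (λ m → c 0 ≤ b 0 + half n * m) ι-zero (close 0)) (≤-reflexive
      (solve 3 (λ b h m → b :+ h :* con 0ℚ := b :+ m :* (con ½ :* h :* con 0ℚ)) refl
        (b 0) (half n) (ι 1))))
  excess (suc i) = ≤-trans (+-mono-≤ (excess i) (close (suc i))) (≤-reflexive (begin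
    (σ b i + ι (suc i) * (½ * half n * ι i)) + (b (suc i) + half n * ι (suc i))
      ≡⟨ solve 5 (λ s b h m m₁ → (s :+ m₁ :* (con ½ :* h :* m)) :+ (b :+ h :* m₁) :=
           (s :+ b) :+ (con 1ℚ :+ (con 1ℚ :+ m)) :* (con ½ :* h :* m₁)) refl
           (σ b i) (b (suc i)) (half n) (ι i) (ι (suc i)) ⟩
    σ b (suc i) + (1ℚ + (1ℚ + ι i)) * (½ * half n * ι (suc i))
      ≡⟨ cong (λ m → σ b (suc i) + m * (½ * half n * ι (suc i)))
           (sym (trans (ι-suc (suc i)) (cong (1ℚ +_) (ι-suc i)))) ⟩
    σ b (suc i) + ι (suc (suc i)) * (½ * half n * ι (suc i)) ∎))
    where open ≡-Reasoning

Close-damp : ∀ n {b c} → Close n b c → Close (suc n) (damp b) (damp c)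
Close-damp n {b} {c} close i = ι*-≤ i (≤-trans (close i) (+-monoʳ-≤ (b i) (excess i)))
  where
  excess : ∀ i → half n * ι i ≤ ι (suc i) * (½ * half n * ι i)
  excess zero = subst (λ m → half n * m ≤ ι 1 * (½ * half n * m)) (sym ι-zero)
    (≤-reflexive (solve 2 (λ h m → h :* con 0ℚ := m :* (con ½ :* h :* con 0ℚ)) refl (half n) (ι 1)))
  excess (suc i) = subst₂ (λ m₁ m₂ → half n * m₁ ≤ m₂ * (½ * half n * m₁)) (sym (ι-suc i))
    (sym (trans (ι-suc (suc i)) (cong (1ℚ +_) (ι-suc i))))
    (≤-by-diff (solve 2 (λ h m →
        (con 1ℚ :+ (con 1ℚ :+ m)) :* (con ½ :* h :* (con 1ℚ :+ m)) :- h :* (con 1ℚ :+ m) :=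
        (con ½ :* h) :* (m :* (con 1ℚ :+ m)) :- con 0ℚ) refl (half n) (ι i))
      (0≤* (0≤half (suc n)) (0≤* (0≤ι i) (0≤+ (nonNegative⁻¹ 1ℚ) (0≤ι i)))))

-- Of the p + 1 halvings one is kept, so that the exponent counts entries whatever their size.
Close-block : ∀ p {n b c} → Close n b c → Close (suc n) (block p b) (block p c)
Close-block zero    {n} close = Close-damp n close
Close-block (suc p) {n} {b} {c} close = Close-pred (suc n) {block (suc p) b} {block (suc p) c}
  (Close-mean (suc n) {block p b} {block p c} (Close-block p {n} {b} {c} close))

Close-act : ∀ ps {n b c} → Close n b c → Close (length ps ℕ.+ n) (act ps b) (act ps c)
Close-act []       close = close
Close-act (p ∷ ps) {n} {b} {c} close =
  Close-block p {length ps ℕ.+ n} {act ps b} {act ps c} (Close-act ps {n} {b} {c} close)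

Close-δ-𝟏 : Close 0 δ 𝟏
Close-δ-𝟏 zero    = ≤-reflexive (sym (cong (λ t → 1ℚ + 1ℚ * t) ι-zero))
Close-δ-𝟏 (suc i) = ≤-by-diff
  (trans (cong (λ t → (0ℚ + 1ℚ * t) - 1ℚ) (ι-suc i))
    (solve 1 (λ m → (con 0ℚ :+ con 1ℚ :* (con 1ℚ :+ m)) :- con 1ℚ := m :- con 0ℚ) refl (ι i)))
  (0≤ι i)

-- As `mean` fixes 𝟏, each application halves the distance of the cut from it; hence the tiles
-- exhaust everything below 𝟏.
Close-cut : ∀ p → Close p (cut p) 𝟏
Close-cut zero    = Close-δ-𝟏
Close-cut (suc p) i = subst (_≤ cut (suc p) i + half (suc p) * ι i) (mean-𝟏 i)
  (Close-mean p (Close-cut p) i)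

-- The weighted sum `L` and its limits.

L-mono : ∀ M {b c} → b ≼ c → L M b ≤ L M c
L-mono zero    b≼c = ≤-refl
L-mono (suc M) b≼c = *-monoˡ-≤ 0≤½ (+-mono-≤ (b≼c 0) (L-mono M (b≼c ∘ suc)))

L-nonNeg : ∀ M {b} → (∀ i → 0ℚ ≤ b i) → 0ℚ ≤ L M b
L-nonNeg zero    b≥0 = ≤-refl
L-nonNeg (suc M) b≥0 = 0≤* 0≤½ (0≤+ (b≥0 0) (L-nonNeg M (b≥0 ∘ suc)))

L-incr : ∀ {M N b} → (∀ i → 0ℚ ≤ b i) → M ℕ.≤ N → L M b ≤ L N b
L-incr {N = N} b≥0 ℕ.z≤n       = L-nonNeg N b≥0
L-incr {b = b} b≥0 (ℕ.s≤s M≤N) = *-monoˡ-≤ 0≤½ (+-monoʳ-≤ (b 0) (L-incr (b≥0 ∘ suc) M≤N))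

L-𝟏 : ∀ M {b} → b ≼ 𝟏 → L M b ≤ 1ℚ
L-𝟏 zero    b≤1 = nonNegative⁻¹ 1ℚ
L-𝟏 (suc M) b≤1 = *-monoˡ-≤ 0≤½ (+-mono-≤ (b≤1 0) (L-𝟏 M (b≤1 ∘ suc)))

-- The weights from index M on add up to at most 2^-M.
L-tail : ∀ {M N b} → b ≼ 𝟏 → M ℕ.≤ N → L N b ≤ L M b + half M
L-tail {N = N} b≤1 ℕ.z≤n = L-𝟏 N b≤1
L-tail {suc M} {suc N} {b} b≤1 (ℕ.s≤s M≤N) = ≤-trans
  (*-monoˡ-≤ 0≤½ (+-monoʳ-≤ (b 0) (L-tail (b≤1 ∘ suc) M≤N)))
  (≤-reflexive (solve 3 (λ b l h → con ½ :* (b :+ (l :+ h)) := con ½ :* (b :+ l) :+ con ½ :* h) refl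
    (b 0) (L M (b ∘ suc)) (half M)))

-- The series of 2^-(i+1) and of i 2^-(i+1) both have sum 1. Affine excesses make the induction
-- close: shifting i turns p into p + t.
L-affine : ∀ M {b c p t} → 0ℚ ≤ p → 0ℚ ≤ t → (∀ i → c i ≤ b i + (p + t * ι i)) →
           L M c ≤ L M b + (p + t)
L-affine zero    0≤p 0≤t c≤ = 0≤+ ≤-refl (0≤+ 0≤p 0≤t)
L-affine (suc M) {b} {c} {p} {t} 0≤p 0≤t c≤ = ≤-trans
  (*-monoˡ-≤ 0≤½ (+-mono-≤ (subst (λ m → c 0 ≤ b 0 + (p + t * m)) ι-zero (c≤ 0))
    (L-affine M {b ∘ suc} {c ∘ suc} {p + t} {t} (0≤+ 0≤p 0≤t) 0≤t λ i → ≤-trans (c≤ (suc i)) (≤-reflexive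
      (trans (cong (λ m → b (suc i) + (p + t * m)) (ι-suc i))
        (solve 4 (λ b p t m → b :+ (p :+ t :* (con 1ℚ :+ m)) := b :+ ((p :+ t) :+ t :* m)) refl
          (b (suc i)) p t (ι i)))))))
  (≤-reflexive (solve 4 (λ b l p t →
      con ½ :* ((b :+ (p :+ t :* con 0ℚ)) :+ (l :+ ((p :+ t) :+ t))) := con ½ :* (b :+ l) :+ (p :+ t)) refl
    (b 0) (L M (b ∘ suc)) p t))

L-close : ∀ M n {b c} → Close n b c → L M c ≤ L M b + half n
L-close M n {b} {c} close = subst (λ t → L M c ≤ L M b + t) (+-identityˡ (half n))
  (L-affine M ≤-refl (0≤half n) λ i → subst (λ t → c i ≤ b i + t)
    (sym (+-identityˡ (half n * ι i))) (close i))

-- Index 1 has weight 1/4 and is counted as soon as M ≥ 2.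
L-gap : ∀ {M b c} → 2 ℕ.≤ M → b ≼ c → L M b + ½ * (½ * (c 1 - b 1)) ≤ L M c
L-gap {suc (suc M)} {b} {c} (ℕ.s≤s (ℕ.s≤s _)) b≼c = ≤-by-diff
  (solve 6 (λ b₀ b₁ l c₀ c₁ m →
      con ½ :* (c₀ :+ con ½ :* (c₁ :+ m)) :-
        (con ½ :* (b₀ :+ con ½ :* (b₁ :+ l)) :+ con ½ :* (con ½ :* (c₁ :- b₁))) :=
      con ½ :* (c₀ :+ con ½ :* m) :- con ½ :* (b₀ :+ con ½ :* l)) refl
    (b 0) (b 1) (L M (λ i → b (2 ℕ.+ i))) (c 0) (c 1) (L M (λ i → c (2 ℕ.+ i))))
  (*-monoˡ-≤ 0≤½ (+-mono-≤ (b≼c 0) (*-monoˡ-≤ 0≤½ (L-mono M (λ i → b≼c (2 ℕ.+ i))))))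

L-δ : ∀ M → L (suc M) δ ≡ ½
L-δ M = cong (λ t → ½ * (1ℚ + t)) (L-zero M)
  where
  L-zero : ∀ M → L M (λ _ → 0ℚ) ≡ 0ℚ
  L-zero zero    = refl
  L-zero (suc M) = cong (λ t → ½ * (0ℚ + t)) (L-zero M)

∣-∣≤-width : ∀ {l u w x y} → u ≤ l + w → l ≤ x → x ≤ u → l ≤ y → y ≤ u → ∣ x - y ∣ ≤ w
∣-∣≤-width {l} {u} {w} {x} {y} u≤l+w l≤x x≤u l≤y y≤u = ∣-∣≤ {x} {y} (bound x≤u l≤y) (bound y≤u l≤x)
  where
  bound : ∀ {x y} → x ≤ u → l ≤ y → x - y ≤ w
  bound {x} {y} x≤u l≤y = ≤-by-diff
    (solve 5 (λ l u w x y → w :- (x :- y) := ((u :+ y) :+ (l :+ w)) :- ((x :+ l) :+ u)) refl l u w x y)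
    (+-mono-≤ (+-mono-≤ x≤u l≤y) u≤l+w)

val : ∀ b → Unit b → ℝ
val b (b≥0 , b≤1) = mkℝ (λ M → L M b) isCauchy
  where
  isCauchy : IsCauchy (λ M → L M b)
  isCauchy ε 0<ε = let N , half< = half→0 0<ε in N , λ m n N≤m N≤n → ≤-<-trans
    (∣-∣≤-width {L N b} {L N b + half N} ≤-refl
      (L-incr b≥0 N≤m) (L-tail b≤1 N≤m) (L-incr b≥0 N≤n) (L-tail b≤1 N≤n))
    (half< N ℕ.≤-refl)

-- Nested intervals and their common point.

lower upper : (ℕ → ℕ) → ℕ → Seq
lower e r = act (applyUpTo e r) δ
upper e r = act (applyUpTo e r) 𝟏

Unit-lower : ∀ e r → Unit (lower e r)
Unit-lower e r = Unit-act (applyUpTo e r) Unit-δ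

Unit-upper : ∀ e r → Unit (upper e r)
Unit-upper e r = Unit-act (applyUpTo e r) Unit-𝟏

δ≼act-δ : ∀ ps → δ ≼ act ps δ
δ≼act-δ []       i = ≤-refl
δ≼act-δ (p ∷ ps) = ≼-trans (δ≼cut p)
  (≼-trans (cut≼block-δ p) (act-mono (p ∷ []) (δ≼act-δ ps)))

lower-mono : ∀ e {r s} → r ℕ.≤ s → lower e r ≼ lower e s
lower-mono e {s = s} ℕ.z≤n = δ≼act-δ (applyUpTo e s)
lower-mono e (ℕ.s≤s r≤s)   = act-mono (e 0 ∷ []) (lower-mono (e ∘ suc) r≤s)

upper-anti : ∀ e {r s} → r ℕ.≤ s → upper e s ≼ upper e r
upper-anti e {s = s} ℕ.z≤n = proj₂ (Unit-upper e s)
upper-anti e (ℕ.s≤s r≤s)   = act-mono (e 0 ∷ []) (upper-anti (e ∘ suc) r≤s)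

lower≼upper : ∀ e r → lower e r ≼ upper e r
lower≼upper e r = act-mono (applyUpTo e r) (proj₂ Unit-δ)

width : ∀ e r M → L M (upper e r) ≤ L M (lower e r) + half r
width e r M = L-close M r (subst (λ n → Close n (lower e r) (upper e r))
  (trans (ℕ.+-identityʳ _) (length-applyUpTo e r)) (Close-act (applyUpTo e r) {0} {δ} {𝟏} Close-δ-𝟏))

-- A diagonal: the entries and the series are truncated at the same N.
η-seq : (ℕ → ℕ) → ℕ → ℚ
η-seq e N = L N (upper e N)

lower≤η : ∀ e {r N} → r ℕ.≤ N → L N (lower e r) ≤ η-seq e N
lower≤η e {r} {N} r≤N = L-mono N (≼-trans (lower-mono e r≤N) (lower≼upper e N))

η≤upper : ∀ e {r N} → r ℕ.≤ N → η-seq e N ≤ L N (upper e r)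
η≤upper e {r} {N} r≤N = L-mono N (upper-anti e r≤N)

η : (ℕ → ℕ) → ℝ
η e = mkℝ (η-seq e) isCauchy
  where
  isCauchy : IsCauchy (η-seq e)
  -- One 2^-N pays for the interval of the first N entries, another for the tail of the series.
  isCauchy ε 0<ε = let N , half< = half→0 (½*-pos 0<ε) in N , λ m n N≤m N≤n → ≤-<-trans
    (∣-∣≤-width (wide N) (above N≤m) (below N≤m) (above N≤n) (below N≤n))
    (subst (half N + half N <_) (solve 1 (λ e → con ½ :* e :+ con ½ :* e := e) refl ε)
      (+-mono-< (half< N ℕ.≤-refl) (half< N ℕ.≤-refl)))
    where
    wide : ∀ N → L N (upper e N) + half N ≤ L N (lower e N) + (half N + half N)
    wide N = ≤-trans (+-monoˡ-≤ (half N) (width e N N)) (≤-reflexive (+-assoc (L N (lower e N)) (half N) (half N)))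
    above : ∀ {N m} → N ℕ.≤ m → L N (lower e N) ≤ η-seq e m
    above {N} N≤m = ≤-trans (L-incr (proj₁ (Unit-lower e N)) N≤m) (lower≤η e N≤m)
    below : ∀ {N m} → N ℕ.≤ m → η-seq e m ≤ L N (upper e N) + half N
    below {N} N≤m = ≤-trans (η≤upper e N≤m) (L-tail (proj₂ (Unit-upper e N)) N≤m)

-- Convergence of the multiple sums.

-- The strict order on reals asks for a positive rational margin; working with ε/2 leaves ε/2 for
-- it.
⟶-intro : ∀ {u ℓ} → (∀ {ε} → 0ℚ < ε → ∃ λ N → ∀ n → N ℕ.≤ n →
  ∃ λ M → ∀ m → M ℕ.≤ m → ∣ seq (u n) m - seq ℓ m ∣ < ε) → u ⟶ ℓ
⟶-intro {u} {ℓ} close ε 0<ε = proj₁ close½ , λ n N≤n →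
  ½ * ε , ½*-pos 0<ε , proj₁ (proj₂ close½ n N≤n) , λ m M≤m →
  subst (∣ seq (u n) m - seq ℓ m ∣ + ½ * ε <_)
    (solve 1 (λ e → con ½ :* e :+ con ½ :* e := e) refl ε)
    (+-monoˡ-< (½ * ε) (proj₂ (proj₂ close½ n N≤n) m M≤m))
  where close½ = close (½*-pos 0<ε)

-- Duality makes Euler's transformation applicable, and vanishing removes its endpoint error.
coact-dual : ∀ ps → Dual (act ps 𝟏) (coact ps δ) × Vanish (coact ps δ)
coact-dual ps = act-corel (λ f g → Dual f g × Vanish g)
  (λ (D , van) → Dual-mean D , Vanish-damp (row≥0 D) van)
  (λ (D , van) → Dual-damp D , Vanish-mean van)
  ps (Dual-𝟏-δ , Vanish-δ)
  where
  row≥0 : ∀ {f g} → Dual f g → ∀ n → 0ℚ ≤ g n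
  row≥0 D n = subst (0ℚ ≤_) (Dual.row D n) (Dual.c≥0 D 0 n)

alt-cong : ∀ N {f g : Seq} → (∀ i → f i ≡ g i) → alt N f ≡ alt N g
alt-cong zero    f≡g = refl
alt-cong (suc N) f≡g = cong₂ (λ s t → s + sgn N * t) (alt-cong N f≡g) (f≡g N)

L-cong : ∀ M {f g} → (∀ i → f i ≡ g i) → L M f ≡ L M g
L-cong zero    f≡g = refl
L-cong (suc M) f≡g = cong₂ (λ s t → ½ * (s + t)) (f≡g 0) (L-cong M (f≡g ∘ suc))

euler-dual : ∀ {f g} → Dual f g → f ≼ 𝟏 → ∀ N M → ∣ alt N g - L M f ∣ ≤ g N + half M
euler-dual {f} {g} D f≤1 N M = subst₂ _≤_
  (cong₂ (λ s t → ∣ s - t ∣) (alt-cong N row) (L-cong M col))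
  (cong₂ _+_ (row N) (*-identityʳ (half M)))
  (∣-∣≤ {alt N (moment 0)} {L M (λ i → moment i 0)} (proj₁ bounds) (proj₂ bounds))
  where
  open Dual D
  bounds = euler N M moment pascal c≥0 {1ℚ} (subst (_≤ 1ℚ) (sym (col 0)) (f≤1 0))

partial-sums-converge : ∀ k r → (λ N → fromℚ (∑≥ (suc r) N (term k))) ⟶
  val (upper (exponents k) (suc r)) (Unit-upper (exponents k) (suc r))
partial-sums-converge k r = ⟶-intro {u = λ N → fromℚ (∑≥ (suc r) N (term k))}
  {val (upper (exponents k) (suc r)) (Unit-upper (exponents k) (suc r))} close
  where
  ps = applyUpTo (exponents k) (suc r)
  close : ∀ {ε} → 0ℚ < ε → ∃ λ N → ∀ n → N ℕ.≤ n → ∃ λ M → ∀ m → M ℕ.≤ m →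
    ∣ ∑≥ (suc r) n (term k) - L m (act ps 𝟏) ∣ < ε
  close {ε} 0<ε = let
      N , a≤ = proj₂ (coact-dual ps) (½*-pos 0<ε)
      M , half< = half→0 (½*-pos 0<ε)
    in N , λ n N≤n → M , λ m M≤m → ≤-<-trans
    (subst (λ t → ∣ t - L m (act ps 𝟏) ∣ ≤ coact ps δ n + half m) (sym (∑≥-term r n k))
      (euler-dual (proj₁ (coact-dual ps)) (proj₂ (Unit-act ps Unit-𝟏)) n m))
    (subst (coact ps δ n + half m <_) (solve 1 (λ e → con ½ :* e :+ con ½ :* e := e) refl ε)
      (+-mono-≤-< (a≤ n N≤n) (half< m M≤m)))

-- The sum of depth r + 1 is the right endpoint of the interval of the first r + 1 entries. The
-- diagonal enters that interval once m > r, and its length is at most 2^-(r+1).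
η-isEta₋₁ : ∀ k → IsEta₋₁ k (η (exponents k))
η-isEta₋₁ k = S , partial-sums-converge k , ⟶-intro {S} {η e} close
  where
  e = exponents k
  S : ℕ → ℝ
  S r = val (upper e (suc r)) (Unit-upper e (suc r))
  close : ∀ {ε} → 0ℚ < ε → ∃ λ N → ∀ r → N ℕ.≤ r → ∃ λ M → ∀ m → M ℕ.≤ m →
    ∣ L m (upper e (suc r)) - η-seq e m ∣ < ε
  close 0<ε = let N , half< = half→0 0<ε in N , λ r N≤r → suc r , λ m r<m → ≤-<-trans
    (∣-∣≤-width (width e (suc r) m) (L-mono m (lower≼upper e (suc r))) ≤-refl
      (lower≤η e r<m) (η≤upper e r<m))
    (half< (suc r) (ℕ.m≤n⇒m≤1+n N≤r))

-- Range and injectivity.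

-- Halving the gap g from `L-gap` makes the inequality strict, with one margin for all M.
≺⇒gap : ∀ {b c} → b ≺ c → ∃ λ ε → 0ℚ < ε × ∀ M → 2 ℕ.≤ M → L M b + ε < L M c
≺⇒gap {b} {c} (b≼c , b<c) = ½ * g , ½*-pos 0<g , λ M 2≤M → <-≤-trans
  (+-monoʳ-< (L M b) (<-by-diff (solve 1 (λ g → g :- con ½ :* g := con ½ :* g :- con 0ℚ) refl g) (½*-pos 0<g)))
  (L-gap 2≤M b≼c)
  where
  g : ℚ
  g = ½ * (½ * (c 1 - b 1))
  0<g : 0ℚ < g
  0<g = ½*-pos (½*-pos {c 1 - b 1} (<-by-diff
    (solve 2 (λ b c → (c :- b) :- con 0ℚ := c :- b) refl (b 1) (c 1)) b<c))

½≤η : ∀ e → fromℚ ½ ≤ᵣ η e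
½≤η e ε 0<ε = 1 , bound
  where
  bound : ∀ n → 1 ℕ.≤ n → ½ < η-seq e n + ε
  bound (suc n) _ = ≤-<-trans
    (subst (_≤ η-seq e (suc n)) (L-δ n) (lower≤η e {0} {suc n} ℕ.z≤n))
    (<-by-diff (solve 2 (λ x e → (x :+ e) :- x := e :- con 0ℚ) refl (η-seq e (suc n)) ε) 0<ε)

block-𝟏≺𝟏 : ∀ p → block p 𝟏 ≺ 𝟏
block-𝟏≺𝟏 p = ≼-≺-trans (block-𝟏≼cut p) (cut≺𝟏 (suc p))

-- The tile of the first entry alone stays below 𝟏 by a fixed margin.
η<1 : ∀ e → η e <ᵣ fromℚ 1ℚ
η<1 e = let ε , 0<ε , gap = ≺⇒gap (block-𝟏≺𝟏 (e 0)) in ε , 0<ε , 2 , λ n 2≤n → <-≤-trans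
  (≤-<-trans (+-monoˡ-≤ ε (η≤upper e (ℕ.≤-trans (ℕ.n≤1+n 1) 2≤n))) (gap n 2≤n))
  (L-𝟏 n (λ _ → ≤-refl))

act-∷ʳ : ∀ ps p b → act (ps ∷ʳ p) b ≡ act ps (block p b)
act-∷ʳ []       p b = refl
act-∷ʳ (q ∷ ps) p b = cong (block q) (act-∷ʳ ps p b)

act-suc : ∀ e n b → act (applyUpTo e (suc n)) b ≡ act (applyUpTo e n) (block (e n) b)
act-suc e n b = trans (cong (λ ps → act ps b) (sym (applyUpTo-∷ʳ e n))) (act-∷ʳ (applyUpTo e n) (e n) b)

-- At the first difference the larger entry selects a tile further to the right.
lex-< : ∀ e f n → applyUpTo e n ≡ applyUpTo f n → e n ℕ.< f n → η e <ᵣ η f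
lex-< e f n eq en<fn = let ε , 0<ε , gap = ≺⇒gap upper≺lower in
  ε , 0<ε , 2 ℕ.+ n , λ m n+2≤m → <-≤-trans
    (≤-<-trans (+-monoˡ-≤ ε (η≤upper e n+2≤m)) (gap m (ℕ.≤-trans (ℕ.m≤m+n 2 n) n+2≤m)))
    (lower≤η f (ℕ.≤-trans (ℕ.n≤1+n (suc n)) n+2≤m))
  where
  upper≺lower : upper e (2 ℕ.+ n) ≺ lower f (suc n)
  -- The tiles of e n and f n may share an endpoint; the next entry of e supplies the strictness,
  -- hence the length n + 2.
  upper≺lower = subst₂ _≺_
    (sym (trans (act-suc e (suc n) 𝟏) (act-suc e n (block (e (suc n)) 𝟏))))
    (trans (cong (λ ps → act ps (block (f n) δ)) eq) (sym (act-suc f n δ)))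
    (act-mono-≺ (applyUpTo e n) (≺-≼-trans (act-mono-≺ (e n ∷ []) (block-𝟏≺𝟏 (e (suc n))))
      (≼-trans (block-𝟏≼cut (e n)) (≼-trans (cut-mono en<fn) (cut≼block-δ (f n))))))

<ᵣ⇒≉ᵣ : ∀ {x y} → x <ᵣ y → ¬ (x ≈ᵣ y)
<ᵣ⇒≉ᵣ {x} {y} (ε , 0<ε , M , x+ε<y) x≈y = <-irrefl refl (<-trans (x+ε<y n (ℕ.m≤m⊔n M N))
  (<-by-diff (solve 3 (λ x y e → (x :+ e) :- y := e :- (y :- x)) refl (seq x n) (seq y n) ε)
    (≤-<-trans (p≤∣p∣ (seq y n - seq x n)) (subst (_< ε) flip (proj₂ (x≈y ε 0<ε) n (ℕ.m≤n⊔m M N))))))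
  where
  N n : ℕ
  N = proj₁ (x≈y ε 0<ε)
  n = M ℕ.⊔ N
  flip : ∣ seq x n - seq y n ∣ ≡ ∣ seq y n - seq x n ∣
  flip = trans (cong ∣_∣ (solve 2 (λ x y → x :- y := :- (y :- x)) refl (seq x n) (seq y n)))
    (∣-p∣≡∣p∣ (seq y n - seq x n))

η-prefix-injective : ∀ e f → η e ≈ᵣ η f → ∀ n → applyUpTo e n ≡ applyUpTo f n → e n ≡ f n
η-prefix-injective e f η≈ n eq with ℕ.<-cmp (e n) (f n)
... | tri≈ _ en≡fn _ = en≡fn
... | tri< en<fn _ _ = contradiction η≈ (<ᵣ⇒≉ᵣ {η e} {η f} (lex-< e f n eq en<fn))
... | tri> _ _ fn<en = contradiction (Setoid.sym ℝ-setoid {η e} {η f} η≈)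
  (<ᵣ⇒≉ᵣ {η f} {η e} (lex-< f e n (sym eq) fn<en))

η-injective : ∀ e f → η e ≈ᵣ η f → ∀ n → e n ≡ f n
η-injective e f η≈ n = η-prefix-injective e f η≈ n (prefix n)
  where
  prefix : ∀ n → applyUpTo e n ≡ applyUpTo f n
  prefix zero    = refl
  prefix (suc n) = trans (sym (applyUpTo-∷ʳ e n)) (trans
    (cong₂ _∷ʳ_ (prefix n) (η-prefix-injective e f η≈ n (prefix n))) (applyUpTo-∷ʳ f n))

applyUpTo-cong : ∀ {e f : ℕ → ℕ} → (∀ n → e n ≡ f n) → ∀ n → applyUpTo e n ≡ applyUpTo f n
applyUpTo-cong e≡f zero    = refl
applyUpTo-cong e≡f (suc n) = cong₂ _∷_ (e≡f 0) (applyUpTo-cong (e≡f ∘ suc) n)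

η-cong : ∀ {e f} → (∀ n → e n ≡ f n) → η e ≈ᵣ η f
η-cong {e} {f} e≡f ε 0<ε = 0 , λ n _ → subst (_< ε)
  (cong ∣_∣ (trans (sym (+-inverseʳ (η-seq e n)))
    (cong (λ ps → η-seq e n - L n (act ps 𝟏)) (applyUpTo-cong e≡f n)))) 0<ε

-- Surjectivity by successive choice of tiles.

-- Both sequences are within q = ε/4 of their values at K. An excess of y over x beyond 2 q at K
-- would witness x < y; otherwise two further errors q add up to ε.
≮ᵣ⇒≥ᵣ : ∀ x y → ¬ (x <ᵣ y) → y ≤ᵣ x
≮ᵣ⇒≥ᵣ x y x≮y ε 0<ε = K , bound
  where
  q : ℚ
  q = ½ * (½ * ε)
  0<q : 0ℚ < q
  0<q = ½*-pos (½*-pos 0<ε)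
  M N K : ℕ
  M = proj₁ (cauchy x q 0<q)
  N = proj₁ (cauchy y q 0<q)
  K = M ℕ.⊔ N
  near-x : ∀ m n → K ℕ.≤ m → K ℕ.≤ n → seq x m - seq x n < q
  near-x m n K≤m K≤n = ≤-<-trans (p≤∣p∣ _) (proj₂ (cauchy x q 0<q) m n
    (ℕ.m⊔n≤o⇒m≤o M N K≤m) (ℕ.m⊔n≤o⇒m≤o M N K≤n))
  near-y : ∀ m n → K ℕ.≤ m → K ℕ.≤ n → seq y m - seq y n < q
  near-y m n K≤m K≤n = ≤-<-trans (p≤∣p∣ _) (proj₂ (cauchy y q 0<q) m n
    (ℕ.m⊔n≤o⇒n≤o M N K≤m) (ℕ.m⊔n≤o⇒n≤o M N K≤n))
  yK≤ : seq y K ≤ seq x K + (q + q)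
  yK≤ = ≮⇒≥ λ yK> → x≮y (seq y K - (seq x K + (q + q)) ,
    <-by-diff (solve 2 (λ y x → (y :- x) :- con 0ℚ := y :- x) refl (seq y K) (seq x K + (q + q))) yK> ,
    K , λ n K≤n → <-by-diff
      (solve 5 (λ xn yn xK yK q → yn :- (xn :+ (yK :- (xK :+ (q :+ q)))) :=
          (q :+ q) :- ((xn :- xK) :+ (yK :- yn))) refl (seq x n) (seq y n) (seq x K) (seq y K) q)
      (+-mono-< (near-x n K K≤n ℕ.≤-refl) (near-y K n ℕ.≤-refl K≤n)))
  bound : ∀ n → K ℕ.≤ n → seq y n < seq x n + ε
  bound n K≤n = <-by-diff
    (solve 5 (λ xn yn xK yK e → let q = con ½ :* (con ½ :* e) in
        (xn :+ e) :- yn := ((q :+ q) :+ (xK :+ (q :+ q))) :- (((yn :- yK) :+ (xK :- xn)) :+ yK)) refl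
      (seq x n) (seq y n) (seq x K) (seq y K) ε)
    (+-mono-<-≤ (+-mono-< (near-y n K K≤n ℕ.≤-refl) (near-x K n ℕ.≤-refl K≤n)) yK≤)

≤ᵣ⇒≯ᵣ : ∀ x y → y ≤ᵣ x → ¬ (x <ᵣ y)
≤ᵣ⇒≯ᵣ x y y≤x (ε , 0<ε , M , x<y) = let N , y<x = y≤x ε 0<ε in
  <-asym (x<y (M ℕ.⊔ N) (ℕ.m≤m⊔n M N)) (y<x (M ℕ.⊔ N) (ℕ.m≤n⊔m M N))

η-unique : ∀ e x → (∀ r → val (lower e r) (Unit-lower e r) ≤ᵣ x) →
  (∀ r → x <ᵣ val (upper e r) (Unit-upper e r)) → η e ≈ᵣ x
η-unique e x lower≤x x<upper ε 0<ε = r ℕ.⊔ (M ℕ.⊔ N) , λ n n≥ → near n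
  (ℕ.m⊔n≤o⇒m≤o r (M ℕ.⊔ N) n≥)
  (ℕ.m⊔n≤o⇒m≤o M N (ℕ.m⊔n≤o⇒n≤o r (M ℕ.⊔ N) n≥))
  (ℕ.m⊔n≤o⇒n≤o M N (ℕ.m⊔n≤o⇒n≤o r (M ℕ.⊔ N) n≥))
  where
  h g : ℚ
  h = ½ * ε
  r M N : ℕ
  r = proj₁ (half→0 (½*-pos 0<ε))
  M = proj₁ (lower≤x r h (½*-pos 0<ε))
  g = proj₁ (x<upper r)
  N = proj₁ (proj₂ (proj₂ (x<upper r)))
  half< : half r < h
  half< = proj₂ (half→0 (½*-pos 0<ε)) r ℕ.≤-refl
  lower< : ∀ n → M ℕ.≤ n → L n (lower e r) < seq x n + h
  lower< = proj₂ (lower≤x r h (½*-pos 0<ε))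
  <upper : ∀ n → N ℕ.≤ n → seq x n < L n (upper e r)
  <upper n N≤n = <-trans
    (<-by-diff (solve 2 (λ x g → (x :+ g) :- x := g :- con 0ℚ) refl (seq x n) g) (proj₁ (proj₂ (x<upper r))))
    (proj₂ (proj₂ (proj₂ (x<upper r))) n N≤n)
  near : ∀ n → r ℕ.≤ n → M ℕ.≤ n → N ℕ.≤ n → ∣ η-seq e n - seq x n ∣ < ε
  near n r≤n M≤n N≤n = ≤-<-trans
    -- The left end is lowered by h = ε/2, since `≤ᵣ` places x above it only up to an error.
    (∣-∣≤-width {l - h} {L n (upper e r)} {h + half r} {η-seq e n} {seq x n}
      (≤-trans (width e r n) (≤-reflexive
        (solve 3 (λ l h t → l :+ t := (l :- h) :+ (h :+ t)) refl l h (half r))))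
      (≤-trans (≤-by-diff (solve 2 (λ l h → l :- (l :- h) := h :- con 0ℚ) refl l h) (<⇒≤ (½*-pos 0<ε)))
        (lower≤η e r≤n))
      (η≤upper e r≤n)
      (≤-by-diff (solve 3 (λ l h x → x :- (l :- h) := (x :+ h) :- l) refl l h (seq x n)) (<⇒≤ (lower< n M≤n)))
      (<⇒≤ (<upper n N≤n)))
    (subst (h + half r <_) (solve 1 (λ e → con ½ :* e :+ con ½ :* e := e) refl ε) (+-monoʳ-< h half<))
    where
    l : ℚ
    l = L n (lower e r)

module _ (em : ExcludedMiddle 0ℓ) where

  -- Searches downwards from n; excluded middle decides each `P n`, later a comparison of reals.
  last-failure : (P : ℕ → Set) → ¬ P 0 → ∀ n → P n → ∃ λ m → ¬ P m × P (suc m)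
  last-failure P ¬P0 zero    P0 = contradiction P0 ¬P0
  last-failure P ¬P0 (suc n) Pn with em {P n}
  ... | yes Pn′ = last-failure P ¬P0 n Pn′
  ... | no ¬Pn  = n , ¬Pn , Pn

  module Digits (x : ℝ) (½≤x : fromℚ ½ ≤ᵣ x) (x<1 : x <ᵣ fromℚ 1ℚ) where

    record Prefix : Set where
      field
        digits : List ℕ
        below  : val (act digits δ) (Unit-act digits Unit-δ) ≤ᵣ x
        above  : x <ᵣ val (act digits 𝟏) (Unit-act digits Unit-𝟏)

    open Prefix

    empty : Prefix
    empty = record
      { digits = []
      ; below  = λ ε 0<ε → 1 ℕ.⊔ proj₁ (½≤x ε 0<ε) , λ
          { (suc n) n≥ → subst (_< seq x (suc n) + ε) (sym (L-δ n))
              (proj₂ (½≤x ε 0<ε) (suc n) (ℕ.m⊔n≤o⇒n≤o 1 (proj₁ (½≤x ε 0<ε)) n≥))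
          ; zero n≥ → contradiction (ℕ.m⊔n≤o⇒m≤o 1 (proj₁ (½≤x ε 0<ε)) n≥) λ () }
      ; above  = above-𝟏 x<1
      }
      where
      above-𝟏 : x <ᵣ fromℚ 1ℚ → x <ᵣ val 𝟏 Unit-𝟏
      -- At stage n the value of 𝟏 is 1 - 2^-n, so half of the margin is spent on 2^-n.
      above-𝟏 (ε , 0<ε , N , x+ε<1) = let M , half< = half→0 (½*-pos 0<ε) in
        ½ * ε , ½*-pos 0<ε , N ℕ.⊔ M , λ n n≥ → <-by-diff
        (solve 4 (λ l x e h → l :- (x :+ con ½ :* e) :=
            (con 1ℚ :+ con ½ :* e :+ (l :+ h)) :- (x :+ e :+ h :+ con 1ℚ)) refl
          (L n 𝟏) (seq x n) ε (half n))
        (+-mono-<-≤ (+-mono-< (x+ε<1 n (ℕ.m⊔n≤o⇒m≤o N M n≥)) (half< n (ℕ.m⊔n≤o⇒n≤o N M n≥))) (1≤ n))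
        where
        1≤ : ∀ n → 1ℚ ≤ L n 𝟏 + half n
        1≤ zero    = ≤-refl
        1≤ (suc n) = ≤-trans (*-monoˡ-≤ 0≤½ (+-monoʳ-≤ 1ℚ (1≤ n))) (≤-reflexive
          (solve 2 (λ l h → con ½ :* (con 1ℚ :+ (l :+ h)) := con ½ :* (con 1ℚ :+ l) :+ con ½ :* h) refl
            (L n 𝟏) (half n)))

    module _ (s : Prefix) where

      cutᵣ : ℕ → ℝ
      cutᵣ p = val (act (digits s) (cut p)) (Unit-act (digits s) (Unit-cut p))

      -- The margin ε below the right endpoint exceeds the distance 2^-p < ε/2 of a late cut from
      -- it.
      some-cut : ∃ λ p → x <ᵣ cutᵣ p
      some-cut = let
          ε , 0<ε , N , x+ε< = above s
          p , half< = half→0 (½*-pos 0<ε)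
        in p , ½ * ε , ½*-pos 0<ε , N , λ n N≤n → <-by-diff
        (solve 5 (λ l u x e h → l :- (x :+ con ½ :* e) :=
            (u :+ con ½ :* e :+ (l :+ h)) :- (x :+ e :+ h :+ u)) refl
          (L n (act (digits s) (cut p))) (L n (act (digits s) 𝟏)) (seq x n) ε (half p))
        (+-mono-<-≤ (+-mono-< (x+ε< n N≤n) (half< p ℕ.≤-refl)) (L-close n p
          (Close-mono {p} {length (digits s) ℕ.+ p} {act (digits s) (cut p)} {act (digits s) 𝟏}
            (ℕ.m≤n+m p (length (digits s))) (Close-act (digits s) {p} {cut p} {𝟏} (Close-cut p)))))

      -- The search starts from a failure because `cut 0` is δ, the left endpoint; the step from
      -- failure to success locates the tile containing x.
      choice : ∃ λ p → ¬ (x <ᵣ cutᵣ p) × x <ᵣ cutᵣ (suc p)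
      choice = last-failure (λ p → x <ᵣ cutᵣ p) (≤ᵣ⇒≯ᵣ x (cutᵣ 0) (below s))
        (proj₁ some-cut) (proj₂ some-cut)

      digit : ℕ
      digit = proj₁ choice

      extend : Prefix
      extend = record
        { digits = digits s ∷ʳ digit
        ; below  = below-cut (≮ᵣ⇒≥ᵣ x (cutᵣ digit) (proj₁ (proj₂ choice)))
        ; above  = above-cut (proj₂ (proj₂ choice))
        }
        where
        below-cut : cutᵣ digit ≤ᵣ x →
          val (act (digits s ∷ʳ digit) δ) (Unit-act (digits s ∷ʳ digit) Unit-δ) ≤ᵣ x
        below-cut cut≤x ε 0<ε = proj₁ (cut≤x ε 0<ε) , λ n n≥ → ≤-<-trans
          (L-mono n (subst (_≼ act (digits s) (cut digit)) (sym (act-∷ʳ (digits s) digit δ))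
            (act-mono (digits s) (block-δ≼cut digit))))
          (proj₂ (cut≤x ε 0<ε) n n≥)
        above-cut : x <ᵣ cutᵣ (suc digit) →
          x <ᵣ val (act (digits s ∷ʳ digit) 𝟏) (Unit-act (digits s ∷ʳ digit) Unit-𝟏)
        above-cut (ε , 0<ε , N , x<cut) = ε , 0<ε , N , λ n N≤n → <-≤-trans (x<cut n N≤n)
          (L-mono n (subst (act (digits s) (cut (suc digit)) ≼_) (sym (act-∷ʳ (digits s) digit 𝟏))
            (act-mono (digits s) (cut≼block-𝟏 digit))))

    prefix : ℕ → Prefix
    prefix zero    = empty
    prefix (suc n) = extend (prefix n)

    expansion : ℕ → ℕ
    expansion n = digit (prefix n)

    digits-prefix : ∀ n → digits (prefix n) ≡ applyUpTo expansion n
    digits-prefix zero    = refl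
    digits-prefix (suc n) = trans (cong (_∷ʳ expansion n) (digits-prefix n)) (applyUpTo-∷ʳ expansion n)

    η-expansion : η expansion ≈ᵣ x
    η-expansion = η-unique expansion x
      (λ r → subst (λ ps → val (act ps δ) (Unit-act ps Unit-δ) ≤ᵣ x) (digits-prefix r) (below (prefix r)))
      (λ r → subst (λ ps → x <ᵣ val (act ps 𝟏) (Unit-act ps Unit-𝟏)) (digits-prefix r) (above (prefix r)))

-- Passage to positive entries and the bijection.

value-exponents-injective : ∀ {k l} → (∀ n → exponents k n ≡ exponents l n) → ∀ n → k n ≡ l n
value-exponents-injective {k} {l} eq n = value-injective
  (trans (sym (suc-exponents k n)) (trans (cong suc (eq n)) (suc-exponents l n)))

η⁺ : (ℕ → ℤ⁺) → Setoid.Carrier [½,1⟩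
η⁺ k = η (exponents k) , ½≤η (exponents k) , η<1 (exponents k)

η⁺-cong : ∀ {k l} → (∀ n → k n ≡ l n) → η (exponents k) ≈ᵣ η (exponents l)
η⁺-cong {k} {l} k≡l = η-cong {exponents k} {exponents l} (λ n → cong (ℕ.pred ∘ value) (k≡l n))

η⁺-injective : ∀ {k l} → η (exponents k) ≈ᵣ η (exponents l) → ∀ n → k n ≡ l n
η⁺-injective {k} {l} η≈ = value-exponents-injective (η-injective (exponents k) (exponents l) η≈)

η⁺-attains : ∀ e x → η e ≈ᵣ x → ∃ λ k → ∀ {l} → (∀ n → l n ≡ k n) → η (exponents l) ≈ᵣ x
η⁺-attains e x η≈x = (λ n → suc (e n) , [ _ ]) , λ {l} l≡k →
  Setoid.trans ℝ-setoid {η (exponents l)} {η e} {x}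
    (η-cong {exponents l} {e} (λ n → cong (ℕ.pred ∘ value) (l≡k n))) η≈x

η-bijection : ExcludedMiddle 0ℓ → Bijection 𝒯̂ [½,1⟩
η-bijection em = record
  { to        = η⁺
  ; cong      = λ {k} {l} → η⁺-cong {k} {l}
  ; bijective = (λ {k} {l} → η⁺-injective {k} {l}) ,
    λ (x , ½≤x , x<1) → η⁺-attains (Digits.expansion em x ½≤x x<1) x (Digits.η-expansion em x ½≤x x<1)
  }

corollary1p3 : ExcludedMiddle 0ℓ → ∃ λ (η : Bijection 𝒯̂ [½,1⟩) → ∀ k → IsEta₋₁ k (proj₁ (Bijection.to η k))
corollary1p3 em = η-bijection em , η-isEta₋₁
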